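{- For each prime number $p \equiv 1 \bmod 4$ there exists a prime number $q \equiv 3 \bmod 4$ such that $\left(\frac{p}{q}\right) = -1$.
   Context: $\left(\frac{p}{q}\right)$ denotes the Legendre symbol modulo the odd prime $q$. -}

module Defs where

open import Data.Bool.Base using (if_then_else_)
open import Data.Fin.Base using (Fin; toℕ; fromℕ<)
open import Data.Fin.Properties using (any?; toℕ-fromℕ<)
open import Data.Integer.Base using (ℤ; +_; _+_; _-_; _*_; 0ℤ; 1ℤ; -1ℤ; _%ℕ_; _/ℕ_)
open import Data.Integer.Divisibility.Signed using (_∣_; _∣?_; divides; ∣m+n∣m⇒∣n)
open import Data.Integer.DivMod using (n%ℕd<d; a≡a%ℕn+[a/ℕn]*n)
open import Data.Integer.Tactic.RingSolver using (solve-∀)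
open import Data.Nat.Base using (ℕ; NonZero)
open import Data.Product.Base using (∃-syntax; _,_)
open import Relation.Binary.PropositionalEquality using (_≡_; refl; sym; trans; cong; subst)
open import Relation.Nullary.Decidable using (Dec; does; map′)

IsSquareMod : ℤ → ℕ → Set
IsSquareMod a q = ∃[ x ] + q ∣ x * x - a

private
  shift : ∀ r t q a → (r + t * q) * (r + t * q) - a ≡ (t * (r + r + t * q)) * q + (r * r - a)
  shift = solve-∀

  reduce : ∀ a q .{{_ : NonZero q}} → IsSquareMod a q →
           ∃[ i ] + q ∣ + toℕ {q} i * + toℕ i - a
  reduce a q (x , q∣x²-a) =
    fromℕ< r<q ,
    subst (λ n → + q ∣ + n * + n - a) (sym (toℕ-fromℕ< r<q))
      (∣m+n∣m⇒∣n {m = (t * (r + r + t * + q)) * + q}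
        (subst (+ q ∣_) eq q∣x²-a)
        (divides (t * (r + r + t * + q)) refl))
    where
    r<q = n%ℕd<d x q
    r = + (x %ℕ q)
    t = x /ℕ q
    eq : x * x - a ≡ (t * (r + r + t * + q)) * + q + (r * r - a)
    eq = trans (cong (λ y → y * y - a) (a≡a%ℕn+[a/ℕn]*n x q)) (shift r t (+ q) a)

isSquareMod? : ∀ a q .{{_ : NonZero q}} → Dec (IsSquareMod a q)
isSquareMod? a q =
  map′ (λ (i , d) → + toℕ i , d) (reduce a q)
    (any? λ (i : Fin q) → + q ∣? + toℕ i * + toℕ i - a)

-- The Legendre symbol (a / q). It has its usual meaning when q is an odd
-- prime; the values at other q are not meaningful.
legendre : (a : ℤ) (q : ℕ) .{{_ : NonZero q}} → ℤ
legendre a q =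
  if does (+ q ∣? a) then 0ℤ
  else if does (isSquareMod? a q) then 1ℤ
  else -1ℤ

{-# OPTIONS --safe #-}

-- Let χ₄ be the nontrivial character mod 4, χ the quadratic character mod p, and φ = χ restricted
-- to odd arguments. Suppose that p is a square mod q for all primes q ≡ 3 (mod 4) below X. By quadratic
-- reciprocity χ q = 1 for all these q, so every odd prime q < X has χ₄ q = 1 or φ q = 1, and hence
-- the Dirichlet convolution f = χ₄ * φ is nonnegative below X and at least 1 at odd squares.
-- Therefore the smoothed sum Σ_{n < X} (X - n) f n is at least of the order of X^(3/2). On the other
-- hand it equals Σ_{d, e} χ₄ d · φ e · max(0, X - d e). Cutting the hyperbola at e = E = √X, a
-- multiple of the period of φ, the periodicity of χ₄ (for e < E) and of φ (for e ≥ E) bounds it by a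
-- constant times X. This is absurd for large X.
module Submission where

open import Defs
open import Algebra.Bundles using (CommutativeMonoid)
import Algebra.Properties.CommutativeMonoid.Sum as CommutativeMonoidSum
import Algebra.Properties.CommutativeSemigroup as CommutativeSemigroupProperties
open import Data.Bool.Base using (true; false; if_then_else_)
open import Data.Fin.Base using (Fin; toℕ; fromℕ<; punchOut)
open import Data.Fin.Permutation using (Permutation′; permutation; _⟨$⟩ʳ_)
open import Data.Fin.Properties using (any?; toℕ<n; toℕ-fromℕ<; toℕ-injective; fromℕ<-injective; punchOut-injective; <⇒notInjective)
import Data.Fin.Properties as Fin
open import Data.Integer.Base as ℤ using (ℤ; +_; -_; _+_; _-_; _*_; _^_; 0ℤ; 1ℤ; -1ℤ; ∣_∣; _%ℕ_; _/ℕ_)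
open import Data.Integer.Divisibility.Signed
open import Data.Integer.DivMod using (a≡a%ℕn+[a/ℕn]*n)
import Data.Integer.Properties as ℤ
open import Data.Integer.Tactic.RingSolver using (solve-∀)
open import Data.List.Base using ([]; _∷_)
open import Data.List.Relation.Unary.All using (_∷_)
open import Data.Nat.Base as ℕ using (ℕ; zero; suc; NonZero; z≤n; s≤s; z<s; s<s; _∸_; _%_; _/_; _!)
import Data.Nat.Divisibility as ℕ
import Data.Nat.DivMod as ℕ
open import Data.Nat.Induction using (<-rec)
import Data.Nat.Properties as ℕ
open import Data.Nat.Primality using (Prime; prime?; prime[2]; ¬prime[1]; euclidsLemma; prime⇒nonZero; prime⇒nonTrivial; prime⇒irreducible)
open import Data.Nat.Primality.Factorisation using (factorise; module PrimeFactorisation)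
open import Data.Nat.Tactic.RingSolver renaming (solve-∀ to ℕ-solve-∀) using ()
open import Data.Product.Base using (_×_; Σ-syntax; ∃-syntax; _,_; proj₁; proj₂)
open import Data.Sum.Base using (_⊎_; inj₁; inj₂; [_,_]′)
open import Data.Unit.Base using (tt)
open import Function.Base using (_∘_; id)
open import Function.Definitions using (Injective)
open import Level using (0ℓ)
open import Relation.Binary.Definitions using (tri<; tri≈; tri>)
open import Relation.Binary.PropositionalEquality using (_≡_; _≢_; refl; sym; trans; cong; cong₂; subst; module ≡-Reasoning)
open import Relation.Nullary using (Dec; yes; no; ¬_; contradiction; does)
open import Relation.Nullary.Decidable using (decidable-stable; dec-false; map′; _×-dec_)

-- The weight `X - n` is what separates the two bounds. With a sharp cutoff the odd squares give
-- about √X / 2, and the hyperbola method leaves an error of order √X, which is no contradiction.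
-- With the weight, the sum over one variable, the other one being fixed at `e`, is a main term plus
-- an error of order `e`. For `χ₄` the main term is X / 2 whatever `e` is, so it cancels against the
-- sum of `φ` over complete periods. For `φ` it is zero: `φ` is even, so its first moment over a
-- period vanishes. Evenness comes from p ≡ 1 (mod 4), which is also what makes reciprocity
-- symmetric. Every bound is an explicit integer inequality and `X` depends on `p` alone, so the
-- contradiction turns into a finite search for `q`.

injective⇒surjective : ∀ {n} (σ : Fin n → Fin n) → Injective _≡_ _≡_ σ → ∀ j → ∃[ i ] σ i ≡ j
injective⇒surjective {suc n} σ inj j with any? (λ i → σ i Fin.≟ j)
... | yes hit = hit
-- If `j` is missed, deleting it from the codomain leaves an injection of `suc n` points into `n`
-- points.
... | no miss = contradiction (λ {i} {k} → inj ∘ punchOut-injective (j≢σ i) (j≢σ k))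
                              (<⇒notInjective {f = λ i → punchOut (j≢σ i)} (ℕ.n<1+n n))
  where
  j≢σ : ∀ i → j ≢ σ i
  j≢σ i j≡σi = miss (i , sym j≡σi)

injective⇒permutation : ∀ {n} (σ : Fin n → Fin n) → Injective _≡_ _≡_ σ →
                        Σ[ π ∈ Permutation′ n ] ∀ i → π ⟨$⟩ʳ i ≡ σ i
injective⇒permutation σ inj =
  permutation σ (proj₁ ∘ onto) (proj₂ ∘ onto) (λ i → inj (proj₂ (onto (σ i)))) , λ _ → refl
  where
  onto = injective⇒surjective σ inj

-- Finite sums and products over initial segments of the naturals

module Fold (M : CommutativeMonoid 0ℓ 0ℓ) where
  open CommutativeMonoid M using (Carrier; _≈_; _∙_; ε; ∙-congˡ; ∙-cong; assoc; identityˡ; identityʳ; reflexive)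
    renaming (refl to ≈-refl; sym to ≈-sym; trans to ≈-trans)
  open CommutativeMonoidSum M using (sum; sum-cong-≋; sum-permute)
  open CommutativeSemigroupProperties (CommutativeMonoid.commutativeSemigroup M) using (interchange)

  -- Summands defined on all of ℕ can be shifted and ranges concatenated without bound proofs; `Fin`
  -- enters only where a permutation is needed.
  fold : ℕ → (ℕ → Carrier) → Carrier
  fold zero    f = ε
  fold (suc n) f = f 0 ∙ fold n (f ∘ suc)

  private
    fold≈sum : ∀ n (f : ℕ → Carrier) → fold n f ≈ sum {n} (f ∘ toℕ)
    fold≈sum zero    f = ≈-refl
    fold≈sum (suc n) f = ∙-congˡ (fold≈sum n (f ∘ suc))

  fold-cong : ∀ n {f g : ℕ → Carrier} → (∀ i → i ℕ.< n → f i ≈ g i) → fold n f ≈ fold n g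
  fold-cong zero    f≈g = ≈-refl
  fold-cong (suc n) f≈g = ∙-cong (f≈g 0 z<s) (fold-cong n (λ i i<n → f≈g (suc i) (s<s i<n)))

  fold-ε : ∀ n {f : ℕ → Carrier} → (∀ i → i ℕ.< n → f i ≈ ε) → fold n f ≈ ε
  fold-ε zero    f≈ε = ≈-refl
  fold-ε (suc n) f≈ε =
    ≈-trans (∙-cong (f≈ε 0 z<s) (fold-ε n (λ i i<n → f≈ε (suc i) (s<s i<n)))) (identityˡ ε)

  fold-∙ : ∀ n (f g : ℕ → Carrier) → fold n (λ i → f i ∙ g i) ≈ fold n f ∙ fold n g
  fold-∙ zero    f g = ≈-sym (identityˡ ε)
  fold-∙ (suc n) f g = ≈-trans (∙-congˡ (fold-∙ n (f ∘ suc) (g ∘ suc))) (interchange _ _ _ _)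

  fold-comm : ∀ m n (f : ℕ → ℕ → Carrier) →
              fold m (λ i → fold n (f i)) ≈ fold n (λ j → fold m (λ i → f i j))
  fold-comm zero    n f = ≈-sym (fold-ε n (λ _ _ → ≈-refl))
  fold-comm (suc m) n f =
    ≈-trans (∙-congˡ (fold-comm m n (f ∘ suc))) (≈-sym (fold-∙ n (f 0) _))

  fold-+ : ∀ m n (f : ℕ → Carrier) → fold (m ℕ.+ n) f ≈ fold m f ∙ fold n (λ i → f (m ℕ.+ i))
  fold-+ zero    n f = ≈-sym (identityˡ _)
  fold-+ (suc m) n f = ≈-trans (∙-congˡ (fold-+ m n (f ∘ suc))) (≈-sym (assoc _ _ _))

  fold-suc : ∀ n (f : ℕ → Carrier) → fold (suc n) f ≈ fold n f ∙ f n
  fold-suc n f =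
    ≈-trans (reflexive (cong (λ k → fold k f) (ℕ.+-comm 1 n)))
      (≈-trans (fold-+ n 1 f)
        (∙-congˡ (≈-trans (identityʳ _) (reflexive (cong f (ℕ.+-identityʳ n))))))

  fold-permute : ∀ n (σ : ℕ → ℕ) → (∀ {i} → i ℕ.< n → σ i ℕ.< n) →
                 (∀ {i j} → i ℕ.< n → j ℕ.< n → σ i ≡ σ j → i ≡ j) →
                 (f : ℕ → Carrier) → fold n (f ∘ σ) ≈ fold n f
  fold-permute n σ σ< σ-inj f =
    ≈-sym (≈-trans (fold≈sum n f) (≈-trans (sum-permute (f ∘ toℕ) π) (≈-trans
      (sum-cong-≋ (λ i → reflexive (cong f (trans (cong toℕ (π≡ i)) (toℕ-fromℕ< _)))))
      (≈-sym (fold≈sum n (f ∘ σ))))))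
    where
    s : Fin n → Fin n
    s i = fromℕ< (σ< (toℕ<n i))
    s-inj : Injective _≡_ _≡_ s
    s-inj {i} {j} eq = toℕ-injective (σ-inj (toℕ<n i) (toℕ<n j) (fromℕ<-injective _ _ _ _ eq))
    π = proj₁ (injective⇒permutation s s-inj)
    π≡ = proj₂ (injective⇒permutation s s-inj)

  fold-select : ∀ n (f : ℕ → Carrier) k → k ℕ.< n → (∀ i → i ≢ k → f i ≈ ε) → fold n f ≈ f k
  fold-select (suc n) f zero k<n f≈ε =
    ≈-trans (∙-congˡ (fold-ε n (λ i _ → f≈ε (suc i) (λ ())))) (identityʳ _)
  fold-select (suc n) f (suc k) (s<s k<n) f≈ε =
    ≈-trans (∙-cong (f≈ε 0 (λ ())) (fold-select n (f ∘ suc) k k<n (λ i i≢k → f≈ε (suc i) (i≢k ∘ ℕ.suc-injective))))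
            (identityˡ _)

open Fold ℤ.+-0-commutativeMonoid
  renaming (fold to ∑; fold-cong to ∑-cong; fold-ε to ∑-zero; fold-∙ to ∑-+; fold-comm to ∑-comm;
            fold-+ to ∑-split; fold-suc to ∑-suc; fold-permute to ∑-permute; fold-select to ∑-select)
open Fold ℤ.*-1-commutativeMonoid
  renaming (fold to ∏; fold-cong to ∏-cong; fold-ε to ∏-one; fold-∙ to ∏-*; fold-comm to ∏-comm;
            fold-permute to ∏-permute)
  hiding (fold-+; fold-suc; fold-select)

∏-const : ∀ n a → ∏ n (λ _ → a) ≡ a ^ n
∏-const zero    a = refl
∏-const (suc n) a = cong (a *_) (∏-const n a)

∏-null : ∀ n f → 0 ℕ.< n → f 0 ≡ 0ℤ → ∏ n f ≡ 0ℤ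
∏-null (suc n) f _ f0≡0 = trans (cong (_* ∏ n (f ∘ suc)) f0≡0) (ℤ.*-zeroˡ (∏ n (f ∘ suc)))

*-^ : ∀ a b n → (a * b) ^ n ≡ a ^ n * b ^ n
*-^ a b n = trans (sym (∏-const n (a * b))) (trans (∏-* n (λ _ → a) (λ _ → b)) (cong₂ _*_ (∏-const n a) (∏-const n b)))

*-distribˡ-∑ : ∀ n c f → c * ∑ n f ≡ ∑ n (λ i → c * f i)
*-distribˡ-∑ zero    c f = ℤ.*-zeroʳ c
*-distribˡ-∑ (suc n) c f = trans (ℤ.*-distribˡ-+ c (f 0) (∑ n (f ∘ suc))) (cong (λ x → c * f 0 + x) (*-distribˡ-∑ n c (f ∘ suc)))

-- Character values -1, 0, 1

data Trit (x : ℤ) : Set where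
  minus : x ≡ -1ℤ → Trit x
  null  : x ≡ 0ℤ → Trit x
  plus  : x ≡ 1ℤ → Trit x

trit-* : ∀ {x y} → Trit x → Trit y → Trit (x * y)
trit-* (minus refl) (minus refl) = plus refl
trit-* (minus refl) (null refl)  = null refl
trit-* (minus refl) (plus refl)  = minus refl
trit-* {y = y} (null refl) _ = null (ℤ.*-zeroˡ y)
trit-* {y = y} (plus refl) t = subst Trit (sym (ℤ.*-identityˡ y)) t

trit-∏ : ∀ n {f : ℕ → ℤ} → (∀ i → Trit (f i)) → Trit (∏ n f)
trit-∏ zero    _ = plus refl
trit-∏ (suc n) t = trit-* (t 0) (trit-∏ n (t ∘ suc))

trit-difference : ∀ {x y} → Trit x → Trit y → ∣ x - y ∣ ℕ.≤ 2
trit-difference (minus refl) (minus refl) = z≤n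
trit-difference (minus refl) (null refl)  = s≤s z≤n
trit-difference (minus refl) (plus refl)  = s≤s (s≤s z≤n)
trit-difference (null refl) (minus refl)  = s≤s z≤n
trit-difference (null refl) (null refl)   = z≤n
trit-difference (null refl) (plus refl)   = s≤s z≤n
trit-difference (plus refl) (minus refl)  = s≤s (s≤s z≤n)
trit-difference (plus refl) (null refl)   = s≤s z≤n
trit-difference (plus refl) (plus refl)   = z≤n

-- Congruences modulo `m`

module Congruence (m : ℕ) where
  infix 4 _≋_
  record _≋_ (a b : ℤ) : Set where
    constructor congruent
    field difference : + m ∣ a - b

  ≋-reflexive : ∀ {a b} → a ≡ b → a ≋ b
  ≋-reflexive {a} refl = congruent (subst (+ m ∣_) (sym (ℤ.+-inverseʳ a)) (divides 0ℤ refl))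

  ≋-refl : ∀ {a} → a ≋ a
  ≋-refl = ≋-reflexive refl

  ≋-sym : ∀ {a b} → a ≋ b → b ≋ a
  ≋-sym {a} {b} (congruent d) = congruent (subst (+ m ∣_) (eq a b) (∣m⇒∣-m d))
    where
    eq : ∀ a b → - (a - b) ≡ b - a
    eq = solve-∀

  ≋-trans : ∀ {a b c} → a ≋ b → b ≋ c → a ≋ c
  ≋-trans {a} {b} {c} (congruent d) (congruent e) =
    congruent (subst (+ m ∣_) (eq a b c) (∣m∣n⇒∣m+n d e))
    where
    eq : ∀ a b c → (a - b) + (b - c) ≡ a - c
    eq = solve-∀

  ≋-* : ∀ {a b c d} → a ≋ b → c ≋ d → a * c ≋ b * d
  ≋-* {a} {b} {c} {d} (congruent e) (congruent f) =
    congruent (subst (+ m ∣_) (eq a b c d) (∣m∣n⇒∣m+n (∣m⇒∣m*n c e) (∣n⇒∣m*n b f)))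
    where
    eq : ∀ a b c d → (a - b) * c + b * (c - d) ≡ a * c - b * d
    eq = solve-∀

  ≋-minus : ∀ {a b c d} → a ≋ b → c ≋ d → a - c ≋ b - d
  ≋-minus {a} {b} {c} {d} (congruent e) (congruent f) =
    congruent (subst (+ m ∣_) (eq a b c d) (∣m∣n⇒∣m-n e f))
    where
    eq : ∀ a b c d → (a - b) - (c - d) ≡ (a - c) - (b - d)
    eq = solve-∀

  ≋-∏ : ∀ n {f g : ℕ → ℤ} → (∀ i → i ℕ.< n → f i ≋ g i) → ∏ n f ≋ ∏ n g
  ≋-∏ zero    _ = ≋-refl
  ≋-∏ (suc n) e = ≋-* (e 0 z<s) (≋-∏ n (λ i i<n → e (suc i) (s<s i<n)))

  ≋-^ : ∀ {a b} n → a ≋ b → a ^ n ≋ b ^ n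
  ≋-^ zero    e = ≋-refl
  ≋-^ (suc n) e = ≋-* e (≋-^ n e)

  ∣⇒≋0 : ∀ {a} → + m ∣ a → a ≋ 0ℤ
  ∣⇒≋0 {a} d = congruent (subst (+ m ∣_) (sym (ℤ.+-identityʳ a)) d)

  ≋0⇒∣ : ∀ {a} → a ≋ 0ℤ → + m ∣ a
  ≋0⇒∣ {a} (congruent d) = subst (+ m ∣_) (ℤ.+-identityʳ a) d

  ≋-% : ∀ a .{{_ : NonZero m}} → + a ≋ + (a % m)
  ≋-% a = congruent (divides (+ (a / m)) (begin
    + a - + (a % m)                            ≡⟨ cong (λ x → + x - + (a % m)) (ℕ.m≡m%n+[m/n]*n a m) ⟩
    + (a % m ℕ.+ a / m ℕ.* m) - + (a % m)      ≡⟨ cong (λ x → + (a % m) + x - + (a % m)) (ℤ.pos-* (a / m) m) ⟩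
    + (a % m) + + (a / m) * + m - + (a % m)    ≡⟨ eq (+ (a % m)) (+ (a / m) * + m) ⟩
    + (a / m) * + m ∎))
    where
    open ≡-Reasoning
    eq : ∀ x y → x + y - x ≡ y
    eq = solve-∀

  ∣∧<⇒≡0 : ∀ {a} → + m ∣ a → ∣ a ∣ ℕ.< m → a ≡ 0ℤ
  ∣∧<⇒≡0 {a} d lt with ∣ a ∣ in eq | ∣⇒∣ᵤ d
  ... | zero  | _  = ℤ.∣i∣≡0⇒i≡0 eq
  ... | suc k | d′ = contradiction lt (ℕ.≤⇒≯ (ℕ.∣⇒≤ d′))

  -- Two such values differ by at most 2, less than the modulus. This lifts Euler's criterion, a
  -- congruence, to identities between values of the character.
  trit-≋⇒≡ : ∀ {x y} → 2 ℕ.< m → Trit x → Trit y → x ≋ y → x ≡ y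
  trit-≋⇒≡ {x} {y} 2<m s t (congruent e) =
    ℤ.i-j≡0⇒i≡j x y (∣∧<⇒≡0 e (ℕ.≤-<-trans (trit-difference s t) 2<m))

  euclidℤ : Prime m → ∀ a b → + m ∣ a * b → (+ m ∣ a) ⊎ (+ m ∣ b)
  euclidℤ pr a b d with euclidsLemma ∣ a ∣ ∣ b ∣ pr (subst (m ℕ.∣_) (ℤ.abs-* a b) (∣⇒∣ᵤ d))
  ... | inj₁ e = inj₁ (∣ᵤ⇒∣ e)
  ... | inj₂ e = inj₂ (∣ᵤ⇒∣ e)

  -- The difference of the squares factors, and Euclid's lemma then cancels `a`. It serves to
  -- compare two multiples of `a` whose absolutely least residues agree up to sign.
  squares-≋ : Prime m → ∀ {x y a} → ¬ (+ m ∣ a) → (x * a) * (x * a) ≋ (y * a) * (y * a) →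
              (+ m ∣ x - y) ⊎ (+ m ∣ x + y)
  squares-≋ pr {x} {y} {a} m∤a (congruent d) =
    [ inj₁ ∘ cancel (x - y) ∘ subst (+ m ∣_) (difference x y a)
    , inj₂ ∘ cancel (x + y) ∘ subst (+ m ∣_) (sym (ℤ.*-distribʳ-+ a x y)) ]′
      (euclidℤ pr (x * a - y * a) (x * a + y * a) (subst (+ m ∣_) (factor (x * a) (y * a)) d))
    where
    factor : ∀ u v → u * u - v * v ≡ (u - v) * (u + v)
    factor = solve-∀
    difference : ∀ x y a → x * a - y * a ≡ (x - y) * a
    difference = solve-∀
    cancel : ∀ u → + m ∣ u * a → + m ∣ u
    cancel u e = [ id , (λ e′ → contradiction e′ m∤a) ]′ (euclidℤ pr u a e)

  ≋-unit-square : ∀ {x s y} → s * s ≡ 1ℤ → x ≋ s * y → x * x ≋ y * y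
  ≋-unit-square {x} {s} {y} s²≡1 x≋sy = ≋-trans (≋-* x≋sy x≋sy)
    (≋-reflexive (trans (eq s y) (trans (cong (_* (y * y)) s²≡1) (ℤ.*-identityˡ (y * y)))))
    where
    eq : ∀ s m → (s * m) * (s * m) ≡ (s * s) * (m * m)
    eq = solve-∀

  ∤-∏ : Prime m → ∀ n f → (∀ i → i ℕ.< n → ¬ (+ m ∣ f i)) → ¬ (+ m ∣ ∏ n f)
  ∤-∏ pr zero f ∤f d = ¬prime[1] (subst Prime (ℕ.∣1⇒≡1 (∣⇒∣ᵤ d)) pr)
  ∤-∏ pr (suc n) f ∤f d with euclidℤ pr (f 0) _ d
  ... | inj₁ e = ∤f 0 z<s e
  ... | inj₂ e = ∤-∏ pr n (f ∘ suc) (λ i i<n → ∤f (suc i) (s<s i<n)) e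

-- sgn h r * (1 + idx h r) is the absolutely least residue of r modulo 2h + 1.
sgn : ℕ → ℕ → ℤ
sgn h zero    = 0ℤ
sgn h (suc r) = if does (r ℕ.<? h) then 1ℤ else -1ℤ

idx : ℕ → ℕ → ℕ
idx h zero    = 0
idx h (suc r) = if does (r ℕ.<? h) then r else (h ℕ.+ h ∸ suc r)

data Residue (h r : ℕ) : Set where
  null : r ≡ 0 → sgn h r ≡ 0ℤ → Residue h r
  low  : idx h r ℕ.< h → r ≡ suc (idx h r) → sgn h r ≡ 1ℤ → Residue h r
  high : idx h r ℕ.< h → r ℕ.+ suc (idx h r) ≡ suc (h ℕ.+ h) → sgn h r ≡ -1ℤ → Residue h r

residue : ∀ h r → r ℕ.< suc (h ℕ.+ h) → Residue h r
residue h zero    _ = null refl refl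
residue h (suc r) (s<s r<2h) with r ℕ.<? h in eq
... | yes r<h = low (subst (ℕ._< h) (sym i≡) r<h) (cong suc (sym i≡)) (cong (λ d → if does d then 1ℤ else -1ℤ) eq)
  where
  i≡ : idx h (suc r) ≡ r
  i≡ = cong (λ d → if does d then r else (h ℕ.+ h ∸ suc r)) eq
... | no r≮h = high (subst (ℕ._< h) (sym i≡) small)
                    (trans (cong (λ i → suc r ℕ.+ suc i) i≡)
                           (trans (ℕ.+-suc (suc r) _) (cong suc (ℕ.m+[n∸m]≡n r<2h))))
                    (cong (λ d → if does d then 1ℤ else -1ℤ) eq)
  where
  i≡ : idx h (suc r) ≡ h ℕ.+ h ∸ suc r
  i≡ = cong (λ d → if does d then r else (h ℕ.+ h ∸ suc r)) eq
  small : h ℕ.+ h ∸ suc r ℕ.< h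
  small = ℕ.+-cancelˡ-< (suc r) _ _ (ℕ.≤-trans (ℕ.≤-reflexive (cong suc (ℕ.m+[n∸m]≡n r<2h))) (ℕ.+-monoˡ-≤ h (s≤s (ℕ.≮⇒≥ r≮h))))

trit-sgn : ∀ h r → Trit (sgn h r)
trit-sgn h zero    = null refl
trit-sgn h (suc r) with r ℕ.<ᵇ h
... | true  = plus refl
... | false = minus refl

residue-idx : ∀ {h r} → r ≢ 0 → Residue h r → idx h r ℕ.< h
residue-idx r≢0 (null r≡0 _)   = contradiction r≡0 r≢0
residue-idx r≢0 (low i<h _ _)  = i<h
residue-idx r≢0 (high i<h _ _) = i<h

residue-unit : ∀ {h r} → r ≢ 0 → Residue h r → sgn h r * sgn h r ≡ 1ℤ
residue-unit r≢0 (null r≡0 _)  = contradiction r≡0 r≢0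
residue-unit r≢0 (low _ _ s≡)  = cong₂ _*_ s≡ s≡
residue-unit r≢0 (high _ _ s≡) = cong₂ _*_ s≡ s≡

-- Finite differences

Δ^ : ℕ → (ℕ → ℤ) → ℕ → ℤ
Δ^ zero    f x = f x
Δ^ (suc n) f x = Δ^ n f (suc x) - Δ^ n f x

-- The Leibniz rule for differences: the second difference of the factor `y` vanishes, so only two
-- terms survive.
Δ^-shift : ∀ n f x → Δ^ (suc n) (λ y → + y * f y) x ≡ + x * Δ^ (suc n) f x + + suc n * Δ^ n f (suc x)
Δ^-shift zero    f x = eq (+ x) (f x) (f (suc x))
  where
  eq : ∀ x a b → (1ℤ + x) * b - x * a ≡ x * (b - a) + 1ℤ * b
  eq = solve-∀
Δ^-shift (suc n) f x =
  trans (cong₂ _-_ (Δ^-shift n f (suc x)) (Δ^-shift n f x))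
        (eq (+ x) (+ suc n) (Δ^ (suc n) f x) (Δ^ n f (suc x)) (Δ^ n f (suc (suc x))))
  where
  eq : ∀ x n a b c → ((1ℤ + x) * (c - b) + n * c) - (x * a + n * b) ≡ x * ((c - b) - a) + (1ℤ + n) * (c - b)
  eq = solve-∀

-- The two halves are proved together, because `Δ^-shift` expresses each difference of the next
-- power through both orders of difference of this one.
Δ^-power : ∀ n x → Δ^ n (λ y → (+ y) ^ n) x ≡ + (n !) × Δ^ (suc n) (λ y → (+ y) ^ n) x ≡ 0ℤ
Δ^-power zero    x = refl , refl
Δ^-power (suc n) x =
  (begin
    Δ^ (suc n) (λ y → + y * g y) x                          ≡⟨ Δ^-shift n g x ⟩
    + x * Δ^ (suc n) g x + + suc n * Δ^ n g (suc x)         ≡⟨ cong₂ (λ a b → + x * a + + suc n * b) (proj₂ (Δ^-power n x)) (proj₁ (Δ^-power n (suc x))) ⟩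
    + x * 0ℤ + + suc n * + (n !)                            ≡⟨ cong (_+ + suc n * + (n !)) (ℤ.*-zeroʳ (+ x)) ⟩
    0ℤ + + suc n * + (n !)                                  ≡⟨ ℤ.+-identityˡ _ ⟩
    + suc n * + (n !)                                       ≡⟨ ℤ.pos-* (suc n) (n !) ⟨
    + (suc n !)                                             ∎) ,
  (begin
    Δ^ (suc (suc n)) (λ y → + y * g y) x                                    ≡⟨ Δ^-shift (suc n) g x ⟩
    + x * (Δ^ (suc n) g (suc x) - Δ^ (suc n) g x) + + suc (suc n) * Δ^ (suc n) g (suc x)
      ≡⟨ cong₂ (λ a b → + x * (a - b) + + suc (suc n) * a) (proj₂ (Δ^-power n (suc x))) (proj₂ (Δ^-power n x)) ⟩
    + x * 0ℤ + + suc (suc n) * 0ℤ                           ≡⟨ cong₂ _+_ (ℤ.*-zeroʳ (+ x)) (ℤ.*-zeroʳ (+ suc (suc n))) ⟩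
    0ℤ ∎)
  where
  open ≡-Reasoning
  g : ℕ → ℤ
  g y = (+ y) ^ n

-- The quadratic character

module GaussCharacter (h : ℕ) (p-prime : Prime (suc (h ℕ.+ h))) where
  p : ℕ
  p = suc (h ℕ.+ h)

  open Congruence p

  0<h : 0 ℕ.< h
  0<h = ℕ.n≢0⇒n>0 λ { refl → ¬prime[1] p-prime }

  2<p : 2 ℕ.< p
  2<p = s<s (ℕ.+-mono-≤ 0<h 0<h)

  -- The Legendre symbol modulo `p`, with Gauss's lemma taken as its definition. Its values are -1,
  -- 0 or 1 by construction, and Euler's criterion becomes the theorem `gauss`.
  χ : ℕ → ℤ
  χ a = ∏ h (λ j → sgn h (suc j ℕ.* a % p))

  trit-χ : ∀ a → Trit (χ a)
  trit-χ a = trit-∏ h (λ j → trit-sgn h (suc j ℕ.* a % p))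

  ∤-small : ∀ {i} → suc i ℕ.< p → ¬ (+ p ∣ + suc i)
  ∤-small i<p d = contradiction i<p (ℕ.≤⇒≯ (ℕ.∣⇒≤ (∣⇒∣ᵤ d)))

  ∤-half : ∀ {i} → i ℕ.< h → ¬ (+ p ∣ + suc i)
  ∤-half i<h = ∤-small (s<s (ℕ.<-≤-trans i<h (ℕ.m≤m+n h h)))

  sgn-idx : ∀ r → r ℕ.< p → + r ≋ sgn h r * + suc (idx h r)
  sgn-idx r r<p with residue h r r<p
  ... | null r≡0 s≡ = ≋-reflexive (trans (cong +_ r≡0) (sym (trans (cong (_* + suc (idx h r)) s≡) (ℤ.*-zeroˡ (+ suc (idx h r))))))
  ... | low _ r≡ s≡ = ≋-reflexive (trans (cong +_ r≡) (sym (trans (cong (_* + suc (idx h r)) s≡) (ℤ.*-identityˡ (+ suc (idx h r))))))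
  ... | high _ r+i≡p s≡ = congruent (divides 1ℤ (trans (cong (λ s → + r - s * + suc (idx h r)) s≡)
                             (trans (eq (+ r) (+ suc (idx h r))) (cong (λ x → 1ℤ * + x) r+i≡p))))
    where
    eq : ∀ r s → r - -1ℤ * s ≡ 1ℤ * (r + s)
    eq = solve-∀

  module _ {a : ℕ} (p∤a : ¬ (+ p ∣ + a)) where
    ρ : ℕ → ℕ
    ρ j = suc j ℕ.* a % p

    ρ<p : ∀ j → ρ j ℕ.< p
    ρ<p j = ℕ.m%n<n (suc j ℕ.* a) p

    ρ-≋ : ∀ j → + suc j * + a ≋ + ρ j
    ρ-≋ j = ≋-trans (≋-reflexive (sym (ℤ.pos-* (suc j) a))) (≋-% (suc j ℕ.* a))

    ρ≢0 : ∀ {j} → j ℕ.< h → ρ j ≢ 0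
    ρ≢0 {j} j<h r≡0 = [ ∤-half j<h , p∤a ]′
      (euclidℤ p-prime (+ suc j) (+ a) (≋0⇒∣ (≋-trans (ρ-≋ j) (≋-reflexive (cong +_ r≡0)))))

    σ : ℕ → ℕ
    σ j = idx h (ρ j)

    σ< : ∀ {j} → j ℕ.< h → σ j ℕ.< h
    σ< {j} j<h = residue-idx (ρ≢0 j<h) (residue h (ρ j) (ρ<p j))

    sgn-unit : ∀ {j} → j ℕ.< h → sgn h (ρ j) * sgn h (ρ j) ≡ 1ℤ
    sgn-unit {j} j<h = residue-unit (ρ≢0 j<h) (residue h (ρ j) (ρ<p j))

    suc-σ : ∀ j → + suc j * + a ≋ sgn h (ρ j) * + suc (σ j)
    suc-σ j = ≋-trans (ρ-≋ j) (sgn-idx (ρ j) (ρ<p j))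

    -- If σ i = σ j then (i + 1)² ≡ (j + 1)², and 0 < i + 1, j + 1 ≤ h excludes i + 1 ≡ - (j + 1).
    σ-injective : ∀ {i j} → i ℕ.< h → j ℕ.< h → σ i ≡ σ j → i ≡ j
    σ-injective {i} {j} i<h j<h σi≡σj = [ equal , opposite ]′
      (squares-≋ p-prime {+ suc i} {+ suc j} {+ a} p∤a
        (≋-trans (squared i i<h)
          (≋-trans (≋-reflexive (cong (λ m → + suc m * + suc m) σi≡σj)) (≋-sym (squared j j<h)))))
      where
      squared : ∀ k → k ℕ.< h → (+ suc k * + a) * (+ suc k * + a) ≋ + suc (σ k) * + suc (σ k)
      squared k k<h = ≋-unit-square {+ suc k * + a} {sgn h (ρ k)} {+ suc (σ k)} (sgn-unit k<h) (suc-σ k)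
      i+j<p : suc i ℕ.+ suc j ℕ.< p
      i+j<p = s<s (ℕ.+-mono-≤ i<h j<h)
      equal : + p ∣ + suc i - + suc j → i ≡ j
      equal d = ℕ.suc-injective (ℤ.+-injective (ℤ.i-j≡0⇒i≡j (+ suc i) (+ suc j)
        (∣∧<⇒≡0 d (ℕ.≤-<-trans (ℤ.∣i-j∣≤∣i∣+∣j∣ (+ suc i) (+ suc j)) i+j<p))))
      opposite : + p ∣ + suc i + + suc j → i ≡ j
      opposite d = contradiction d (∤-small i+j<p)

    private
      F : ℤ
      F = ∏ h (λ j → + suc j)

      -- Multiply the congruences `suc-σ` over all `j`: the signs give `χ a`, and the absolute
      -- values are a rearrangement of 1, ..., h. Since `F` = h! is prime to `p`, it can be
      -- cancelled afterwards.
      F*a^h≋χ*F : F * (+ a) ^ h ≋ χ a * F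
      F*a^h≋χ*F =
        ≋-trans (≋-reflexive (trans (cong (F *_) (sym (∏-const h (+ a)))) (sym (∏-* h (λ j → + suc j) (λ _ → + a)))))
        (≋-trans (≋-∏ h (λ j _ → suc-σ j))
          (≋-reflexive (trans (∏-* h (λ j → sgn h (ρ j)) (λ j → + suc (σ j)))
            (cong (χ a *_) (∏-permute h σ σ< σ-injective (λ j → + suc j))))))

    gauss-unit : (+ a) ^ h ≋ χ a
    gauss-unit =
      [ (λ p∣F → contradiction p∣F (∤-∏ p-prime h (λ j → + suc j) (λ _ → ∤-half))) , congruent ]′
        (euclidℤ p-prime F ((+ a) ^ h - χ a) (subst (+ p ∣_) (eq F ((+ a) ^ h) (χ a)) (_≋_.difference F*a^h≋χ*F)))
      where
      eq : ∀ f a x → f * a - x * f ≡ f * (a - x)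
      eq = solve-∀

  χ-null : ∀ {a} → + p ∣ + a → χ a ≡ 0ℤ
  χ-null {a} p∣a = ∏-null h _ 0<h (cong (sgn h) (ℕ.n∣m⇒m%n≡0 (1 ℕ.* a) p
    (subst (p ℕ.∣_) (sym (ℕ.*-identityˡ a)) (∣⇒∣ᵤ p∣a))))

  -- Euler's criterion for all `a`. When `p` divides `a` both sides are 0, the power because its
  -- exponent `h` is positive.
  gauss : ∀ a → (+ a) ^ h ≋ χ a
  gauss a with + p ∣? + a
  ... | no p∤a  = gauss-unit p∤a
  ... | yes p∣a = ≋-trans (≋-^ h (∣⇒≋0 p∣a)) (≋-trans (≋-reflexive (0^ h 0<h)) (≋-reflexive (sym (χ-null p∣a))))
    where
    0^ : ∀ n → 0 ℕ.< n → 0ℤ ^ n ≡ 0ℤ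
    0^ (suc n) _ = ℤ.*-zeroˡ (0ℤ ^ n)

  -- The power `a ^ h` is multiplicative, and congruent character values are equal.
  χ-* : ∀ a b → χ (a ℕ.* b) ≡ χ a * χ b
  χ-* a b = trit-≋⇒≡ 2<p (trit-χ (a ℕ.* b)) (trit-* (trit-χ a) (trit-χ b))
    (≋-trans (≋-sym (gauss (a ℕ.* b)))
    (≋-trans (≋-reflexive (trans (cong (_^ h) (ℤ.pos-* a b)) (*-^ (+ a) (+ b) h)))
             (≋-* (gauss a) (gauss b))))

  χ-cong : ∀ {a b} → + a ≋ + b → χ a ≡ χ b
  χ-cong {a} {b} a≋b = trit-≋⇒≡ 2<p (trit-χ a) (trit-χ b)
    (≋-trans (≋-sym (gauss a)) (≋-trans (≋-^ h a≋b) (gauss b)))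

  χ≡0⇒∣ : ∀ {a} → χ a ≡ 0ℤ → + p ∣ + a
  χ≡0⇒∣ {a} χ≡0 = root h (≋0⇒∣ (≋-trans (gauss a) (≋-reflexive χ≡0)))
    where
    root : ∀ n → + p ∣ (+ a) ^ n → + p ∣ + a
    root zero    d = contradiction d (∤-small (ℕ.<-trans (s<s z<s) 2<p))
    root (suc n) d = [ id , root n ]′ (euclidℤ p-prime (+ a) ((+ a) ^ n) d)

  χ-square : ∀ {a} → ¬ (+ p ∣ + a) → χ (a ℕ.* a) ≡ 1ℤ
  χ-square {a} p∤a with trit-χ a
  ... | minus χ≡ = trans (χ-* a a) (cong₂ _*_ χ≡ χ≡)
  ... | null χ≡  = contradiction (χ≡0⇒∣ χ≡) p∤a
  ... | plus χ≡  = trans (χ-* a a) (cong₂ _*_ χ≡ χ≡)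

  χ-isSquareMod : ∀ {a} → ¬ (+ p ∣ + a) → IsSquareMod (+ a) p → χ a ≡ 1ℤ
  χ-isSquareMod {a} p∤a (x , p∣x²-a) = trans (χ-cong (≋-sym r²≋a)) (χ-square p∤r)
    where
    -- `χ` takes naturals, so the integer square root is replaced by its residue.
    r = x %ℕ p
    x≋r : x ≋ + r
    x≋r = congruent (divides (x /ℕ p) (trans (cong (_- + r) (a≡a%ℕn+[a/ℕn]*n x p)) (eq (+ r) (x /ℕ p * + p))))
      where
      eq : ∀ r y → r + y - r ≡ y
      eq = solve-∀
    r²≋a : + (r ℕ.* r) ≋ + a
    r²≋a = ≋-trans (≋-reflexive (ℤ.pos-* r r)) (≋-trans (≋-* (≋-sym x≋r) (≋-sym x≋r)) (congruent p∣x²-a))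
    p∤r : ¬ (+ p ∣ + r)
    p∤r p∣r = p∤a (≋0⇒∣ (≋-trans (≋-sym r²≋a) (∣⇒≋0 (subst (+ p ∣_) (sym (ℤ.pos-* r r)) (∣m⇒∣m*n (+ r) p∣r)))))

  ∤-! : ∀ n → n ℕ.< p → ¬ (+ p ∣ + (n !))
  ∤-! zero    _   d = ∤-small (ℕ.<-trans (s<s z<s) 2<p) d
  ∤-! (suc n) n<p d with euclidℤ p-prime (+ suc n) (+ (n !)) (subst (+ p ∣_) (ℤ.pos-* (suc n) (n !)) d)
  ... | inj₁ e = ∤-small n<p e
  ... | inj₂ e = ∤-! n (ℕ.<-trans (ℕ.n<1+n n) n<p) e

-- Signs of comparisons and parities

step : ℕ → ℕ → ℤ
step x y = if x ℕ.≤ᵇ y then -1ℤ else 1ℤ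

step-≤ : ∀ {x y} → x ℕ.≤ y → step x y ≡ -1ℤ
step-≤ {x} {y} x≤y with x ℕ.≤ᵇ y | ℕ.≤⇒≤ᵇ x≤y
... | true | _ = refl

step-> : ∀ {x y} → y ℕ.< x → step x y ≡ 1ℤ
step-> {x} {y} y<x with x ℕ.≤ᵇ y | ℕ.≤ᵇ⇒≤ x y
... | true  | x≤y = contradiction (x≤y tt) (ℕ.<⇒≱ y<x)
... | false | _   = refl

step-cong : ∀ {x y u v} → (x ℕ.≤ y → u ℕ.≤ v) → (u ℕ.≤ v → x ℕ.≤ y) → step x y ≡ step u v
step-cong {x} {y} f g with ℕ.≤-<-connex x y
... | inj₁ x≤y = trans (step-≤ x≤y) (sym (step-≤ (f x≤y)))
... | inj₂ y<x = trans (step-> y<x) (sym (step-> (ℕ.≰⇒> (ℕ.<⇒≱ y<x ∘ g))))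

-- A lattice point off the diagonal lies on exactly one side of it, so exactly one of the two
-- factors is -1.
step-swap : ∀ {x y} → x ≢ y → step x y * step y x ≡ -1ℤ
step-swap {x} {y} x≢y with ℕ.<-cmp x y
... | tri< x<y _ _ = cong₂ _*_ (step-≤ (ℕ.<⇒≤ x<y)) (step-> x<y)
... | tri≈ _ x≡y _ = contradiction x≡y x≢y
... | tri> _ _ y<x = cong₂ _*_ (step-> y<x) (step-≤ (ℕ.<⇒≤ y<x))

-- Exactly `m` of the `k` comparisons hold. This rewrites a power of -1 as a count of lattice points
-- in a column of height `k`.
∏-step : ∀ k m → m ℕ.≤ k → ∏ k (λ i → step (suc i) m) ≡ -1ℤ ^ m
∏-step zero    zero    _         = refl
∏-step (suc k) zero    _         = ∏-one (suc k) (λ _ _ → refl)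
∏-step (suc k) (suc m) (s≤s m≤k) =
  cong (-1ℤ *_) (trans (∏-cong k (λ i _ → step-cong {suc (suc i)} {suc m} ℕ.s≤s⁻¹ s≤s)) (∏-step k m m≤k))

-1^+ : ∀ m n → -1ℤ ^ (m ℕ.+ n) ≡ -1ℤ ^ m * -1ℤ ^ n
-1^+ = ℤ.^-distribˡ-+-* -1ℤ

-1^-square : ∀ n → -1ℤ ^ n * -1ℤ ^ n ≡ 1ℤ
-1^-square n = trans (sym (*-^ -1ℤ -1ℤ n)) (ℤ.^-zeroˡ n)

-1^-odd* : ∀ m n → -1ℤ ^ (n ℕ.* suc (m ℕ.+ m)) ≡ -1ℤ ^ n
-1^-odd* m n = begin
  -1ℤ ^ (n ℕ.* suc (m ℕ.+ m))           ≡⟨ cong (-1ℤ ^_) (ℕ.*-comm n (suc (m ℕ.+ m))) ⟩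
  -1ℤ ^ (suc (m ℕ.+ m) ℕ.* n)           ≡⟨ ℤ.^-*-assoc -1ℤ (suc (m ℕ.+ m)) n ⟨
  (-1ℤ * -1ℤ ^ (m ℕ.+ m)) ^ n           ≡⟨ cong (λ x → (-1ℤ * x) ^ n) (trans (-1^+ m m) (-1^-square m)) ⟩
  -1ℤ ^ n                               ∎
  where open ≡-Reasoning

-- In the low case `r` equals `suc (idx h r)`; in the high case the two add up to the odd number 2h
-- + 1. So the sign is the parity of their sum.
residue-parity : ∀ {h r} → r ≢ 0 → Residue h r → sgn h r ≡ -1ℤ ^ r * -1ℤ ^ suc (idx h r)
residue-parity r≢0 (null r≡0 _) = contradiction r≡0 r≢0
residue-parity {h} {r} _ (low _ r≡ s≡) =
  trans s≡ (sym (trans (cong (λ x → -1ℤ ^ r * -1ℤ ^ x) (sym r≡)) (-1^-square r)))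
residue-parity {h} {r} _ (high _ r+i≡ s≡) =
  trans s≡ (sym (trans (sym (-1^+ r (suc (idx h r))))
    (trans (cong (-1ℤ ^_) r+i≡) (cong (-1ℤ *_) (trans (-1^+ h h) (-1^-square h))))))

module QuadraticCharacter (h : ℕ) (p-prime : Prime (suc (h ℕ.+ h))) where
  open GaussCharacter h p-prime public
  open Congruence p

  Δ^-const : ∀ n → 0 ℕ.< n → ∀ f c x → (∀ y → x ℕ.≤ y → y ℕ.≤ n ℕ.+ x → f y ≋ c) → Δ^ n f x ≋ 0ℤ
  Δ^-const (suc zero)    _ f c x f≋c =
    ≋-trans (≋-minus (f≋c (suc x) (ℕ.n≤1+n x) ℕ.≤-refl) (f≋c x ℕ.≤-refl (ℕ.n≤1+n x))) (≋-reflexive (ℤ.+-inverseʳ c))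
  Δ^-const (suc (suc n)) _ f c x f≋c = ≋-minus
    (Δ^-const (suc n) z<s f c (suc x) (λ y x<y y≤ → f≋c y (ℕ.<⇒≤ x<y) (ℕ.≤-trans y≤ (ℕ.≤-reflexive (ℕ.+-suc (suc n) x)))))
    (Δ^-const (suc n) z<s f c x (λ y x≤y y≤ → f≋c y x≤y (ℕ.m≤n⇒m≤1+n y≤)))

  -- Otherwise x ^ h would be constant on 1, …, h + 1, but its h-th difference is h !.
  χ-nontrivial : ¬ (∀ a → 0 ℕ.< a → a ℕ.< p → χ a ≡ 1ℤ)
  χ-nontrivial χ≡1 = ∤-! h (s<s (ℕ.m≤m+n h h)) (≋0⇒∣ (≋-trans (≋-reflexive (sym (proj₁ (Δ^-power h 1))))
    (Δ^-const h 0<h (λ y → (+ y) ^ h) 1ℤ 1 (λ y 0<y y≤ → ≋-trans (gauss y) (≋-reflexive (χ≡1 y 0<y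
      (s≤s (ℕ.≤-trans y≤ (ℕ.+-monoʳ-≤ h 0<h)))))))))

  module _ {a : ℕ} (p∤a : ¬ (+ p ∣ + a)) where
    mul : ℕ → ℕ
    mul x = a ℕ.* x % p

    mul-≋ : ∀ x → + a * + x ≋ + mul x
    mul-≋ x = ≋-trans (≋-reflexive (sym (ℤ.pos-* a x))) (≋-% (a ℕ.* x))

    mul-injective : ∀ {x y} → x ℕ.< p → y ℕ.< p → mul x ≡ mul y → x ≡ y
    mul-injective {x} {y} x<p y<p mx≡my =
      ℤ.+-injective (ℤ.i-j≡0⇒i≡j (+ x) (+ y) (∣∧<⇒≡0 p∣x-y small))
      where
      small : ∣ + x - + y ∣ ℕ.< p
      small = subst (λ z → ∣ z ∣ ℕ.< p) (sym (ℤ.m-n≡m⊖n x y)) (ℕ.≤-<-trans (ℤ.∣m⊝n∣≤m⊔n x y) (ℕ.⊔-pres-<m x<p y<p))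
      factor : ∀ a x y → a * x - a * y ≡ a * (x - y)
      factor = solve-∀
      p∣x-y : + p ∣ + x - + y
      p∣x-y = [ (λ p∣a → contradiction p∣a p∤a) , id ]′ (euclidℤ p-prime (+ a) (+ x - + y)
        (subst (+ p ∣_) (factor (+ a) (+ x) (+ y)) (_≋_.difference
          (≋-trans (mul-≋ x) (≋-trans (≋-reflexive (cong +_ mx≡my)) (≋-sym (mul-≋ y)))))))

    -- Multiplication by a unit permutes the residues modulo `p`.
    χ*∑χ : χ a * ∑ p χ ≡ ∑ p χ
    χ*∑χ = begin
      χ a * ∑ p χ                      ≡⟨ *-distribˡ-∑ p (χ a) χ ⟩
      ∑ p (λ x → χ a * χ x)            ≡⟨ ∑-cong p (λ x _ → trans (sym (χ-* a x)) (χ-cong (≋-% (a ℕ.* x)))) ⟩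
      ∑ p (χ ∘ mul)                    ≡⟨ ∑-permute p mul (λ {x} _ → ℕ.m%n<n (a ℕ.* x) p) mul-injective χ ⟩
      ∑ p χ                            ∎
      where open ≡-Reasoning

  -- A nonzero sum could be cancelled from `χ*∑χ`, making `χ` trivial on the units.
  ∑χ≡0 : ∑ p χ ≡ 0ℤ
  ∑χ≡0 = decidable-stable (∑ p χ ℤ.≟ 0ℤ) λ ∑≢0 → χ-nontrivial λ { (suc a) _ a<p →
    ℤ.*-cancelʳ-≡ (χ (suc a)) 1ℤ (∑ p χ) {{ℤ.≢-nonZero ∑≢0}}
      (trans (χ*∑χ (∤-small a<p)) (sym (ℤ.*-identityˡ (∑ p χ)))) }

  -- By Euler's criterion `χ` is as even as the power with exponent `h`, and `h` is even exactly
  -- because p ≡ 1 (mod 4).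
  χ-neg : ∀ {m} → h ≡ m ℕ.+ m → ∀ {a b} → + a ≋ - (+ b) → χ a ≡ χ b
  χ-neg {m} h≡2m {a} {b} a≋-b = trit-≋⇒≡ 2<p (trit-χ a) (trit-χ b)
    (≋-trans (≋-sym (gauss a)) (≋-trans (≋-^ h a≋-b) (≋-trans (≋-reflexive even) (gauss b))))
    where
    sq : ∀ x → (- x) * (- x) ≡ x * x
    sq = solve-∀
    even : (- (+ b)) ^ h ≡ (+ b) ^ h
    even = begin
      (- (+ b)) ^ h                      ≡⟨ cong ((- (+ b)) ^_) h≡2m ⟩
      (- (+ b)) ^ (m ℕ.+ m)              ≡⟨ ℤ.^-distribˡ-+-* (- (+ b)) m m ⟩
      (- (+ b)) ^ m * (- (+ b)) ^ m      ≡⟨ *-^ (- (+ b)) (- (+ b)) m ⟨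
      ((- (+ b)) * (- (+ b))) ^ m        ≡⟨ cong (_^ m) (sq (+ b)) ⟩
      (+ b * + b) ^ m                    ≡⟨ *-^ (+ b) (+ b) m ⟩
      (+ b) ^ m * (+ b) ^ m              ≡⟨ ℤ.^-distribˡ-+-* (+ b) m m ⟨
      (+ b) ^ (m ℕ.+ m)                  ≡⟨ cong ((+ b) ^_) h≡2m ⟨
      (+ b) ^ h                          ∎
      where open ≡-Reasoning

  module _ {k : ℕ} (p∤a : ¬ (+ p ∣ + suc (k ℕ.+ k))) where
    private
      a : ℕ
      a = suc (k ℕ.+ k)
      r : ℕ → ℕ
      r j = suc j ℕ.* a % p
      s : ℕ → ℕ
      s j = suc j ℕ.* a / p

    -- Reduce `suc j * a = r j + s j * p` modulo 2: both `a` and `p` are odd.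
    parity : ∀ j → -1ℤ ^ r j ≡ -1ℤ ^ suc j * -1ℤ ^ s j
    parity j = begin
      -1ℤ ^ r j                                      ≡⟨ ℤ.*-identityʳ _ ⟨
      -1ℤ ^ r j * 1ℤ                                 ≡⟨ cong (-1ℤ ^ r j *_) (-1^-square (s j)) ⟨
      -1ℤ ^ r j * (-1ℤ ^ s j * -1ℤ ^ s j)            ≡⟨ ℤ.*-assoc (-1ℤ ^ r j) _ _ ⟨
      -1ℤ ^ r j * -1ℤ ^ s j * -1ℤ ^ s j              ≡⟨ cong (λ x → -1ℤ ^ r j * x * -1ℤ ^ s j) (-1^-odd* h (s j)) ⟨
      -1ℤ ^ r j * -1ℤ ^ (s j ℕ.* p) * -1ℤ ^ s j      ≡⟨ cong (_* -1ℤ ^ s j) (-1^+ (r j) (s j ℕ.* p)) ⟨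
      -1ℤ ^ (r j ℕ.+ s j ℕ.* p) * -1ℤ ^ s j          ≡⟨ cong (λ x → -1ℤ ^ x * -1ℤ ^ s j) (ℕ.m≡m%n+[m/n]*n (suc j ℕ.* a) p) ⟨
      -1ℤ ^ (suc j ℕ.* a) * -1ℤ ^ s j                ≡⟨ cong (_* -1ℤ ^ s j) (-1^-odd* k (suc j)) ⟩
      -1ℤ ^ suc j * -1ℤ ^ s j                        ∎
      where open ≡-Reasoning

    -- The permutation σ cancels every factor except the parities of the quotients.
    eisenstein : χ a ≡ ∏ h (λ j → -1ℤ ^ s j)
    eisenstein = begin
      χ a                                                          ≡⟨ ∏-cong h pointwise ⟩
      ∏ h (λ j → -1ℤ ^ suc j * -1ℤ ^ s j * -1ℤ ^ suc (σ p∤a j))    ≡⟨ ∏-* h (λ j → -1ℤ ^ suc j * -1ℤ ^ s j) _ ⟩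
      ∏ h (λ j → -1ℤ ^ suc j * -1ℤ ^ s j) * ∏ h (λ j → -1ℤ ^ suc (σ p∤a j))
        ≡⟨ cong₂ _*_ (∏-* h (λ j → -1ℤ ^ suc j) (λ j → -1ℤ ^ s j)) (∏-permute h (σ p∤a) (σ< p∤a) (σ-injective p∤a) (λ j → -1ℤ ^ suc j)) ⟩
      A * B * A                                                    ≡⟨ rearrange A B ⟩
      (A * A) * B                                                  ≡⟨ cong (_* B) (trans (sym (∏-* h (λ j → -1ℤ ^ suc j) _)) (∏-one h (λ j _ → -1^-square (suc j)))) ⟩
      1ℤ * B                                                       ≡⟨ ℤ.*-identityˡ B ⟩
      B                                                            ∎
      where
      open ≡-Reasoning
      A = ∏ h (λ j → -1ℤ ^ suc j)
      B = ∏ h (λ j → -1ℤ ^ s j)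
      rearrange : ∀ x y → x * y * x ≡ (x * x) * y
      rearrange = solve-∀
      pointwise : ∀ j → j ℕ.< h → sgn h (r j) ≡ -1ℤ ^ suc j * -1ℤ ^ s j * -1ℤ ^ suc (σ p∤a j)
      pointwise j j<h = trans (residue-parity (ρ≢0 p∤a j<h) (residue h (r j) (ρ<p p∤a j)))
                              (cong (_* -1ℤ ^ suc (σ p∤a j)) (parity j))

    -- The quotient `s j` counts the multiples of `p` up to `suc j * a`, that is, the lattice points
    -- of column `j` below the diagonal. No point is lost at height `k`, since `s j` never exceeds
    -- `k`.
    χ-step : χ a ≡ ∏ h (λ j → ∏ k (λ i → step (suc i ℕ.* p) (suc j ℕ.* a)))
    χ-step = trans eisenstein (∏-cong h (λ j j<h → sym (trans (∏-cong k (λ i _ → step-cong (multiple j i) (quotient′ j i)))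
                                                       (∏-step k (s j) (s≤k j j<h)))))
      where
      multiple : ∀ j i → suc i ℕ.* p ℕ.≤ suc j ℕ.* a → suc i ℕ.≤ s j
      multiple j i le = ℕ.≤-trans (ℕ.≤-reflexive (sym (ℕ.m*n/n≡m (suc i) p))) (ℕ./-monoˡ-≤ p le)
      quotient′ : ∀ j i → suc i ℕ.≤ s j → suc i ℕ.* p ℕ.≤ suc j ℕ.* a
      quotient′ j i le = ℕ.≤-trans (ℕ.*-monoˡ-≤ p le) (ℕ.m/n*n≤m (suc j ℕ.* a) p)
      s≤k : ∀ j → j ℕ.< h → s j ℕ.≤ k
      s≤k j j<h = ℕ.s≤s⁻¹ (ℕ.m<n*o⇒m/o<n {suc j ℕ.* a} {suc k} {p} (ℕ.≤-<-trans (ℕ.*-monoˡ-≤ a j<h) half))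
        where
        eq : ∀ h k → suc k ℕ.* suc (h ℕ.+ h) ≡ suc (h ℕ.* suc (k ℕ.+ k)) ℕ.+ (h ℕ.+ k)
        eq = ℕ-solve-∀
        half : h ℕ.* a ℕ.< suc k ℕ.* p
        half = ℕ.≤-trans (ℕ.m≤m+n _ (h ℕ.+ k)) (ℕ.≤-reflexive (sym (eq h k)))

-- Quadratic reciprocity

module Reciprocity {h k m : ℕ} (p-prime : Prime (suc (h ℕ.+ h))) (q-prime : Prime (suc (k ℕ.+ k)))
                   (h≡2m : h ≡ m ℕ.+ m) where
  private
    module P = QuadraticCharacter h p-prime
    module Q = QuadraticCharacter k q-prime
    p q : ℕ
    p = suc (h ℕ.+ h)
    q = suc (k ℕ.+ k)

  -- Eisenstein's count: the two symbols multiply to one factor -1 for each point of the h by k box,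
  -- none of which is on the diagonal. The total (-1)^(h k) is 1 because `h` is even, and signs with
  -- product 1 are equal.
  reciprocity : ¬ (+ p ∣ + q) → ¬ (+ q ∣ + p) → P.χ q ≡ Q.χ p
  reciprocity p∤q q∤p = conclude (P.trit-χ q) (Q.trit-χ p) product
    where
    open ≡-Reasoning
    open Congruence p using (euclidℤ)
    distinct : ∀ {i j} → j ℕ.< h → suc i ℕ.* p ≢ suc j ℕ.* q
    distinct {i} {j} j<h ip≡jq = [ P.∤-half j<h , p∤q ]′ (euclidℤ p-prime (+ suc j) (+ q)
      (divides (+ suc i) (trans (sym (ℤ.pos-* (suc j) q)) (trans (cong +_ (sym ip≡jq)) (ℤ.pos-* (suc i) p)))))
    A B : ℕ → ℕ → ℤ
    A j i = step (suc i ℕ.* p) (suc j ℕ.* q)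
    B j i = step (suc j ℕ.* q) (suc i ℕ.* p)
    product : P.χ q * Q.χ p ≡ 1ℤ
    product = begin
      P.χ q * Q.χ p
        ≡⟨ cong₂ _*_ (P.χ-step {k} p∤q) (trans (Q.χ-step {h} q∤p) (∏-comm k h (λ i j → B j i))) ⟩
      ∏ h (λ j → ∏ k (A j)) * ∏ h (λ j → ∏ k (B j))     ≡⟨ ∏-* h (λ j → ∏ k (A j)) (λ j → ∏ k (B j)) ⟨
      ∏ h (λ j → ∏ k (A j) * ∏ k (B j))
        ≡⟨ ∏-cong h (λ j j<h → trans (sym (∏-* k (A j) (B j))) (trans (∏-cong k (λ i _ → step-swap {suc i ℕ.* p} (distinct {i} {j} j<h))) (∏-const k -1ℤ))) ⟩
      ∏ h (λ _ → -1ℤ ^ k)                                 ≡⟨ ∏-const h (-1ℤ ^ k) ⟩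
      (-1ℤ ^ k) ^ h                                       ≡⟨ cong ((-1ℤ ^ k) ^_) h≡2m ⟩
      (-1ℤ ^ k) ^ (m ℕ.+ m)                               ≡⟨ ℤ.^-distribˡ-+-* (-1ℤ ^ k) m m ⟩
      (-1ℤ ^ k) ^ m * (-1ℤ ^ k) ^ m                       ≡⟨ *-^ (-1ℤ ^ k) (-1ℤ ^ k) m ⟨
      (-1ℤ ^ k * -1ℤ ^ k) ^ m                             ≡⟨ cong (_^ m) (-1^-square k) ⟩
      1ℤ ^ m                                              ≡⟨ ℤ.^-zeroˡ m ⟩
      1ℤ                                                  ∎
    conclude : ∀ {x y} → Trit x → Trit y → x * y ≡ 1ℤ → x ≡ y
    conclude (minus refl) (minus refl) _ = refl
    conclude (plus refl)  (plus refl)  _ = refl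
    conclude {y = y} (null refl) _ xy≡1 = contradiction (trans (sym (ℤ.*-zeroˡ y)) xy≡1) λ ()
    conclude {x = x} _ (null refl) xy≡1 = contradiction (trans (sym (ℤ.*-zeroʳ x)) xy≡1) λ ()
    conclude (minus refl) (plus refl) ()
    conclude (plus refl) (minus refl) ()

-- The character modulo 4 and the parity indicator

χ₄ : ℕ → ℤ
χ₄ 0 = 0ℤ
χ₄ 1 = 1ℤ
χ₄ 2 = 0ℤ
χ₄ 3 = -1ℤ
χ₄ (suc (suc (suc (suc n)))) = χ₄ n

trit-χ₄ : ∀ n → Trit (χ₄ n)
trit-χ₄ 0 = null refl
trit-χ₄ 1 = plus refl
trit-χ₄ 2 = null refl
trit-χ₄ 3 = minus refl
trit-χ₄ (suc (suc (suc (suc n)))) = trit-χ₄ n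

χ₄-periodic : ∀ k n → χ₄ (k ℕ.* 4 ℕ.+ n) ≡ χ₄ n
χ₄-periodic zero    n = refl
χ₄-periodic (suc k) n = χ₄-periodic k n

χ₄-% : ∀ n → χ₄ n ≡ χ₄ (n % 4)
χ₄-% n = trans (cong χ₄ (trans (ℕ.m≡m%n+[m/n]*n n 4) (ℕ.+-comm (n % 4) (n / 4 ℕ.* 4)))) (χ₄-periodic (n / 4) (n % 4))

χ₄-* : ∀ m n → χ₄ (m ℕ.* n) ≡ χ₄ m * χ₄ n
χ₄-* (suc (suc (suc (suc m)))) n =
  trans (cong χ₄ (trans (ℕ.*-distribʳ-+ n 4 m) (cong (ℕ._+ m ℕ.* n) (ℕ.*-comm 4 n)))) (trans (χ₄-periodic n (m ℕ.* n)) (χ₄-* m n))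
χ₄-* 0 n = sym (ℤ.*-zeroˡ (χ₄ n))
χ₄-* 1 n = trans (cong χ₄ (ℕ.*-identityˡ n)) (sym (ℤ.*-identityˡ (χ₄ n)))
χ₄-* 2 0 = refl
χ₄-* 2 1 = refl
χ₄-* 2 2 = refl
χ₄-* 2 3 = refl
χ₄-* 2 (suc (suc (suc (suc n)))) = trans (cong χ₄ (trans (ℕ.*-distribˡ-+ 2 4 n) refl)) (χ₄-* 2 n)
χ₄-* 3 0 = refl
χ₄-* 3 1 = refl
χ₄-* 3 2 = refl
χ₄-* 3 3 = refl
χ₄-* 3 (suc (suc (suc (suc n)))) = trans (cong χ₄ (ℕ.*-distribˡ-+ 3 4 n)) (χ₄-* 3 n)

-- The indicator of odd numbers, written as a square of `χ₄` so that it inherits complete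
-- multiplicativity.
odd : ℕ → ℤ
odd n = χ₄ n * χ₄ n

odd-periodic : ∀ m n → odd (m ℕ.+ m ℕ.+ n) ≡ odd n
odd-periodic zero    n = refl
odd-periodic (suc m) n = trans (cong (λ x → odd (suc (x ℕ.+ n))) (ℕ.+-suc m m)) (trans (shift (m ℕ.+ m ℕ.+ n)) (odd-periodic m n))
  where
  shift : ∀ n → odd (2 ℕ.+ n) ≡ odd n
  shift 0 = refl
  shift 1 = refl
  shift 2 = refl
  shift 3 = refl
  shift (suc (suc (suc (suc n)))) = shift n

odd-reflect : ∀ {m a b} → a ℕ.+ b ≡ m ℕ.+ m → odd a ≡ odd b
odd-reflect {m} {a} {b} a+b≡2m = begin
  odd a                       ≡⟨ odd-periodic b a ⟨
  odd (b ℕ.+ b ℕ.+ a)         ≡⟨ cong odd (trans (ℕ.+-assoc b b a) (trans (cong (b ℕ.+_) (trans (ℕ.+-comm b a) a+b≡2m)) (ℕ.+-comm b (m ℕ.+ m)))) ⟩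
  odd (m ℕ.+ m ℕ.+ b)         ≡⟨ odd-periodic m b ⟩
  odd b                       ∎
  where open ≡-Reasoning

odd-double : ∀ n → odd (n ℕ.+ n) ≡ 0ℤ
odd-double n = trans (cong odd (sym (ℕ.+-identityʳ (n ℕ.+ n)))) (odd-periodic n 0)

odd-suc-double : ∀ n → odd (suc (n ℕ.+ n)) ≡ 1ℤ
odd-suc-double n = trans (cong odd (ℕ.+-comm 1 (n ℕ.+ n))) (odd-periodic n 1)

∑-double : ∀ n f → ∑ (n ℕ.+ n) f ≡ ∑ n (λ i → f (i ℕ.+ i)) + ∑ n (λ i → f (suc (i ℕ.+ i)))
∑-double zero    f = refl
∑-double (suc n) f = begin
  f 0 + ∑ (n ℕ.+ suc n) (f ∘ suc)                        ≡⟨ cong (λ k → f 0 + ∑ k (f ∘ suc)) (ℕ.+-suc n n) ⟩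
  f 0 + (f 1 + ∑ (n ℕ.+ n) (f ∘ suc ∘ suc))              ≡⟨ cong (λ x → f 0 + (f 1 + x)) (∑-double n (f ∘ suc ∘ suc)) ⟩
  f 0 + (f 1 + (∑ n (λ i → f (suc (suc (i ℕ.+ i)))) + ∑ n (λ i → f (suc (suc (suc (i ℕ.+ i)))))))
    ≡⟨ interchange (f 0) (f 1) _ _ ⟩
  (f 0 + ∑ n (λ i → f (suc (suc (i ℕ.+ i))))) + (f 1 + ∑ n (λ i → f (suc (suc (suc (i ℕ.+ i))))))
    ≡⟨ cong₂ (λ x y → (f 0 + x) + (f 1 + y)) (∑-cong n (λ i _ → cong (λ x → f (suc x)) (sym (ℕ.+-suc i i))))
                                             (∑-cong n (λ i _ → cong (λ x → f (suc (suc x))) (sym (ℕ.+-suc i i)))) ⟩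
  (f 0 + ∑ n (λ i → f (suc i ℕ.+ suc i))) + (f 1 + ∑ n (λ i → f (suc (suc i ℕ.+ suc i)))) ∎
  where
  open ≡-Reasoning
  interchange : ∀ a b c d → a + (b + (c + d)) ≡ (a + c) + (b + d)
  interchange = solve-∀

∑-reverse : ∀ n f → ∑ (suc n) (λ i → f (n ∸ i)) ≡ ∑ (suc n) f
∑-reverse n f = ∑-permute (suc n) (n ∸_) (λ {i} _ → s≤s (ℕ.m∸n≤m n i))
  (λ i≤n j≤n eq → ℕ.∸-cancelˡ-≡ (ℕ.s≤s⁻¹ i≤n) (ℕ.s≤s⁻¹ j≤n) eq) f

-- The even character `φ` of period `2p`

module OddCharacter (h : ℕ) (p-prime : Prime (suc (h ℕ.+ h))) {m : ℕ} (h≡2m : h ≡ m ℕ.+ m) where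
  open QuadraticCharacter h p-prime
  open Congruence p

  -- The even arguments are removed on account of the prime 2: with `χ₄ 2` = 0 and `χ 2` = -1 the
  -- convolution would have the value (-1)^k at 2^k. The price is the period `2p` instead of `p`.
  φ : ℕ → ℤ
  φ n = χ n * odd n

  trit-φ : ∀ n → Trit (φ n)
  trit-φ n = trit-* (trit-χ n) (trit-* (trit-χ₄ n) (trit-χ₄ n))

  φ-* : ∀ a b → φ (a ℕ.* b) ≡ φ a * φ b
  φ-* a b = trans (cong₂ (λ x y → x * (y * y)) (χ-* a b) (χ₄-* a b)) (eq (χ a) (χ b) (χ₄ a) (χ₄ b))
    where
    eq : ∀ x y u v → (x * y) * ((u * v) * (u * v)) ≡ (x * (u * u)) * (y * (v * v))
    eq x y u v = trans (cong ((x * y) *_) (swap u v u v)) (swap x y (u * u) (v * v))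
      where
      swap : ∀ a b c d → (a * b) * (c * d) ≡ (a * c) * (b * d)
      swap = solve-∀

  φ-0 : φ 0 ≡ 0ℤ
  φ-0 = ℤ.*-zeroʳ (χ 0)

  2p : ℕ
  2p = p ℕ.+ p

  χ-periodic : ∀ t → χ (p ℕ.+ t) ≡ χ t
  χ-periodic t = χ-cong {p ℕ.+ t} {t} (congruent (divides 1ℤ (eq (+ p) (+ t))))
    where
    eq : ∀ p t → (p + t) - t ≡ 1ℤ * p
    eq = solve-∀

  φ-periodic : ∀ t → φ (2p ℕ.+ t) ≡ φ t
  φ-periodic t = cong₂ _*_ (trans (cong χ (ℕ.+-assoc p p t)) (trans (χ-periodic (p ℕ.+ t)) (χ-periodic t))) (odd-periodic p t)

  φ-reflect : ∀ {s t} → s ℕ.+ t ≡ 2p → φ s ≡ φ t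
  φ-reflect {s} {t} s+t≡2p = cong₂ _*_ (χ-neg {m} h≡2m {s} {t} (congruent (divides (+ 2) s+t))) (odd-reflect {p} {s} {t} s+t≡2p)
    where
    eq₁ : ∀ s t → s - - t ≡ s + t
    eq₁ = solve-∀
    eq₂ : ∀ p → p + p ≡ + 2 * p
    eq₂ = solve-∀
    s+t : + s - - (+ t) ≡ + 2 * + p
    s+t = trans (eq₁ (+ s) (+ t)) (trans (cong +_ s+t≡2p) (eq₂ (+ p)))

  -- The sum of `χ` over two periods is 0, and its even terms contribute `χ 2 * ∑ p χ`, which is 0
  -- too; so the odd terms cancel.
  ∑φ≡0 : ∑ 2p φ ≡ 0ℤ
  ∑φ≡0 = begin
    ∑ 2p φ                                            ≡⟨ ∑-double p φ ⟩
    ∑ p (λ i → φ (i ℕ.+ i)) + ∑ p (λ i → φ (suc (i ℕ.+ i)))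
      ≡⟨ cong₂ _+_ (∑-zero p (λ i _ → trans (cong (χ (i ℕ.+ i) *_) (odd-double i)) (ℤ.*-zeroʳ (χ (i ℕ.+ i)))))
                   (∑-cong p (λ i _ → trans (cong (χ (suc (i ℕ.+ i)) *_) (odd-suc-double i)) (ℤ.*-identityʳ (χ (suc (i ℕ.+ i)))))) ⟩
    0ℤ + O                                            ≡⟨ cong (_+ O) evens ⟨
    ∑ p (λ i → χ (i ℕ.+ i)) + O                       ≡⟨ ∑-double p χ ⟨
    ∑ 2p χ                                            ≡⟨ ∑-split p p χ ⟩
    ∑ p χ + ∑ p (λ i → χ (p ℕ.+ i))                   ≡⟨ cong₂ _+_ ∑χ≡0 (trans (∑-cong p (λ i _ → χ-periodic i)) ∑χ≡0) ⟩
    0ℤ                                                ∎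
    where
    open ≡-Reasoning
    O = ∑ p (λ i → χ (suc (i ℕ.+ i)))
    evens : ∑ p (λ i → χ (i ℕ.+ i)) ≡ 0ℤ
    evens = begin
      ∑ p (λ i → χ (i ℕ.+ i))       ≡⟨ ∑-cong p (λ i _ → trans (cong χ (cong (i ℕ.+_) (sym (ℕ.+-identityʳ i)))) (χ-* 2 i)) ⟩
      ∑ p (λ i → χ 2 * χ i)         ≡⟨ *-distribˡ-∑ p (χ 2) χ ⟨
      χ 2 * ∑ p χ                   ≡⟨ cong (χ 2 *_) ∑χ≡0 ⟩
      χ 2 * 0ℤ                      ≡⟨ ℤ.*-zeroʳ (χ 2) ⟩
      0ℤ                            ∎

  -- Pair `t` with `2p ∸ t`: `φ` takes the same value at both, so twice the sum is `2p` times the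
  -- sum of `φ`. This removes the main term of the smoothed sums of `φ`.
  ∑tφ≡0 : ∑ 2p (λ t → + t * φ t) ≡ 0ℤ
  ∑tφ≡0 = ℤ.*-cancelˡ-≡ (+ 2) S 0ℤ (begin
    + 2 * S                                                       ≡⟨ two S ⟩
    S + S                                                         ≡⟨ cong₂ _+_ S≡S⁺ (trans S≡S⁺ (sym (∑-reverse 2p (λ t → + t * φ t)))) ⟩
    S⁺ + ∑ (suc 2p) (λ t → + (2p ∸ t) * φ (2p ∸ t))               ≡⟨ ∑-+ (suc 2p) (λ t → + t * φ t) (λ t → + (2p ∸ t) * φ (2p ∸ t)) ⟨
    ∑ (suc 2p) (λ t → + t * φ t + + (2p ∸ t) * φ (2p ∸ t))        ≡⟨ ∑-cong (suc 2p) pair ⟩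
    ∑ (suc 2p) (λ t → + 2p * φ t)                                 ≡⟨ *-distribˡ-∑ (suc 2p) (+ 2p) φ ⟨
    + 2p * ∑ (suc 2p) φ                                           ≡⟨ cong (+ 2p *_) (trans (∑-suc 2p φ) (cong₂ _+_ ∑φ≡0 φ-2p)) ⟩
    + 2p * 0ℤ                                                     ≡⟨ ℤ.*-zeroʳ (+ 2p) ⟩
    0ℤ                                                            ∎)
    where
    open ≡-Reasoning
    S = ∑ 2p (λ t → + t * φ t)
    S⁺ = ∑ (suc 2p) (λ t → + t * φ t)
    two : ∀ x → + 2 * x ≡ x + x
    two = solve-∀
    φ-2p : φ 2p ≡ 0ℤ
    φ-2p = trans (φ-reflect {2p} {0} (ℕ.+-identityʳ 2p)) φ-0
    -- The extra term at t = `2p` is 0 and makes the range symmetric under the reflection.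
    S≡S⁺ : S ≡ S⁺
    S≡S⁺ = sym (trans (∑-suc 2p (λ t → + t * φ t))
      (trans (cong (λ x → S + + 2p * x) φ-2p) (trans (cong (λ x → S + x) (ℤ.*-zeroʳ (+ 2p))) (ℤ.+-identityʳ S))))
    pair : ∀ t → t ℕ.< suc 2p → + t * φ t + + (2p ∸ t) * φ (2p ∸ t) ≡ + 2p * φ t
    pair t t≤2p = begin
      + t * φ t + + (2p ∸ t) * φ (2p ∸ t)     ≡⟨ cong (λ x → + t * φ t + + (2p ∸ t) * x) (φ-reflect {2p ∸ t} {t} (ℕ.m∸n+n≡m (ℕ.s≤s⁻¹ t≤2p))) ⟩
      + t * φ t + + (2p ∸ t) * φ t            ≡⟨ ℤ.*-distribʳ-+ (φ t) (+ t) (+ (2p ∸ t)) ⟨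
      + (t ℕ.+ (2p ∸ t)) * φ t                ≡⟨ cong (λ x → + x * φ t) (ℕ.m+[n∸m]≡n (ℕ.s≤s⁻¹ t≤2p)) ⟩
      + 2p * φ t                              ∎

-- Smoothed sums of periodic functions

∣∑∣≤ : ∀ n f B → (∀ i → i ℕ.< n → ∣ f i ∣ ℕ.≤ B) → ∣ ∑ n f ∣ ℕ.≤ n ℕ.* B
∣∑∣≤ zero    f B f≤B = z≤n
∣∑∣≤ (suc n) f B f≤B = ℕ.≤-trans (ℤ.∣i+j∣≤∣i∣+∣j∣ (f 0) (∑ n (f ∘ suc)))
  (ℕ.+-mono-≤ (f≤B 0 z<s) (∣∑∣≤ n (f ∘ suc) B (λ i i<n → f≤B (suc i) (s<s i<n))))

∣trit∣≤1 : ∀ {x} → Trit x → ∣ x ∣ ℕ.≤ 1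
∣trit∣≤1 (minus refl) = s≤s z≤n
∣trit∣≤1 (null refl)  = z≤n
∣trit∣≤1 (plus refl)  = s≤s z≤n

∣trit*∣≤ : ∀ {x} → Trit x → ∀ y → ∣ x * y ∣ ℕ.≤ ∣ y ∣
∣trit*∣≤ {x} t y = ℕ.≤-trans (ℕ.≤-reflexive (ℤ.abs-* x y))
  (ℕ.≤-trans (ℕ.*-monoˡ-≤ ∣ y ∣ (∣trit∣≤1 t)) (ℕ.≤-reflexive (ℕ.*-identityˡ ∣ y ∣)))

∑-periodic : ∀ P g → (∀ t → g (P ℕ.+ t) ≡ g t) → ∑ P g ≡ 0ℤ → ∀ n → ∑ (n ℕ.* P) g ≡ 0ℤ
∑-periodic P g per ∑≡0 zero    = refl
∑-periodic P g per ∑≡0 (suc n) = trans (∑-split P (n ℕ.* P) g)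
  (cong₂ _+_ ∑≡0 (trans (∑-cong (n ℕ.* P) (λ t _ → per t)) (∑-periodic P g per ∑≡0 n)))

periodic : ∀ P (g : ℕ → ℤ) → (∀ t → g (P ℕ.+ t) ≡ g t) → ∀ n t → g (n ℕ.* P ℕ.+ t) ≡ g t
periodic P g per zero    t = refl
periodic P g per (suc n) t = trans (cong g (ℕ.+-assoc P (n ℕ.* P) t)) (trans (per (n ℕ.* P ℕ.+ t)) (periodic P g per n t))

-- A full period weighted by the linear function Y - e t contributes exactly e μ, so only
-- the period in which Y - e t changes sign contributes an error.
module TentSum (P : ℕ) (g : ℕ → ℤ) (μ : ℕ)
               (trit : ∀ t → Trit (g t)) (per : ∀ t → g (P ℕ.+ t) ≡ g t)
               (∑g≡0 : ∑ P g ≡ 0ℤ) (∑tg≡-μ : ∑ P (λ t → + t * g t) ≡ - (+ μ)) where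

  tent : ℕ → ℕ → ℕ → ℤ
  tent n e Y = ∑ (n ℕ.* P) (λ t → g t * + (Y ∸ e ℕ.* t))

  tent-suc : ∀ n e Y → tent (suc n) e Y ≡ ∑ P (λ t → g t * + (Y ∸ e ℕ.* t)) + tent n e (Y ∸ e ℕ.* P)
  tent-suc n e Y = trans (∑-split P (n ℕ.* P) (λ t → g t * + (Y ∸ e ℕ.* t)))
    (cong (λ x → ∑ P (λ t → g t * + (Y ∸ e ℕ.* t)) + x) (∑-cong (n ℕ.* P) (λ t _ →
      cong₂ (λ x y → x * + y) (per t) (trans (cong (Y ∸_) (ℕ.*-distribˡ-+ e P t)) (sym (ℕ.∸-+-assoc Y (e ℕ.* P) (e ℕ.* t)))))))

  tent-null : ∀ n e → tent n e 0 ≡ 0ℤ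
  tent-null n e = ∑-zero (n ℕ.* P) (λ t _ → trans (cong (λ x → g t * + x) (ℕ.0∸n≡0 (e ℕ.* t))) (ℤ.*-zeroʳ (g t)))

  full-period : ∀ e Y → e ℕ.* P ℕ.≤ Y → ∑ P (λ t → g t * + (Y ∸ e ℕ.* t)) ≡ + e * + μ
  full-period e Y eP≤Y = begin
    ∑ P (λ t → g t * + (Y ∸ e ℕ.* t))                          ≡⟨ ∑-cong P linear ⟩
    ∑ P (λ t → + Y * g t + (- (+ e)) * (+ t * g t))            ≡⟨ ∑-+ P (λ t → + Y * g t) (λ t → (- (+ e)) * (+ t * g t)) ⟩
    ∑ P (λ t → + Y * g t) + ∑ P (λ t → (- (+ e)) * (+ t * g t))
      ≡⟨ cong₂ _+_ (*-distribˡ-∑ P (+ Y) g) (*-distribˡ-∑ P (- (+ e)) (λ t → + t * g t)) ⟨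
    + Y * ∑ P g + (- (+ e)) * ∑ P (λ t → + t * g t)            ≡⟨ cong₂ (λ x y → + Y * x + (- (+ e)) * y) ∑g≡0 ∑tg≡-μ ⟩
    + Y * 0ℤ + (- (+ e)) * (- (+ μ))                           ≡⟨ simplify (+ Y) (+ e) (+ μ) ⟩
    + e * + μ                                                  ∎
    where
    open ≡-Reasoning
    simplify : ∀ y e m → y * 0ℤ + (- e) * (- m) ≡ e * m
    simplify = solve-∀
    expand : ∀ x y e t → x * (y - e * t) ≡ y * x + (- e) * (t * x)
    expand = solve-∀
    linear : ∀ t → t ℕ.< P → g t * + (Y ∸ e ℕ.* t) ≡ + Y * g t + (- (+ e)) * (+ t * g t)
    linear t t<P = trans (cong (g t *_) (trans (sym (ℤ.⊖-≥ (ℕ.≤-trans (ℕ.*-monoʳ-≤ e (ℕ.<⇒≤ t<P)) eP≤Y)))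
                                               (trans (sym (ℤ.m-n≡m⊖n Y (e ℕ.* t))) (cong (λ x → + Y - x) (ℤ.pos-* e t)))))
                         (expand (g t) (+ Y) (+ e) (+ t))

  -- The part `P * (P * P)` comes from `P` times an incomplete period of `P` terms, each at most
  -- `e * P`; the part `μ * P` comes from `μ * Y` with `Y` below `e * P`. For `χ₄` this is 4 · 16 +
  -- 2 · 4 = 72, for `φ` the cube of its period.
  C : ℕ
  C = P ℕ.* (P ℕ.* P) ℕ.+ μ ℕ.* P

  -- The difference is unchanged when a full period is removed and `Y` drops by `e * P`. So the
  -- induction runs down to `Y` below `e * P`, where both terms are estimated trivially, or to `Y` =
  -- 0. The factor `P` avoids the fraction μ Y / P, and the hypothesis says that the `n` periods
  -- cover the support of the weight.
  tent-bound : ∀ n e Y → Y ℕ.≤ e ℕ.* (n ℕ.* P) → ∣ + P * tent n e Y - + μ * + Y ∣ ℕ.≤ C ℕ.* e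
  tent-bound zero e Y Y≤ with refl ← ℕ.n≤0⇒n≡0 (ℕ.≤-trans Y≤ (ℕ.≤-reflexive (ℕ.*-zeroʳ e))) =
    subst (λ x → ∣ x ∣ ℕ.≤ C ℕ.* e) (sym (vanish (+ P) (+ μ))) z≤n
    where
    vanish : ∀ p m → p * 0ℤ - m * 0ℤ ≡ 0ℤ
    vanish = solve-∀
  tent-bound (suc n) e Y Y≤ with ℕ.≤-<-connex (e ℕ.* P) Y
  ... | inj₁ eP≤Y = subst (λ x → ∣ x ∣ ℕ.≤ C ℕ.* e) (sym invariant) (tent-bound n e Y′ Y′≤)
    where
    Y′ = Y ∸ e ℕ.* P
    Y′≤ : Y′ ℕ.≤ e ℕ.* (n ℕ.* P)
    Y′≤ = ℕ.m≤n+o⇒m∸n≤o Y (e ℕ.* P) (ℕ.≤-trans Y≤ (ℕ.≤-reflexive (ℕ.*-distribˡ-+ e P (n ℕ.* P))))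
    cancel : ∀ p e m k y → p * (e * m + k) - m * (e * p + y) ≡ p * k - m * y
    cancel = solve-∀
    invariant : + P * tent (suc n) e Y - + μ * + Y ≡ + P * tent n e Y′ - + μ * + Y′
    invariant = trans (cong₂ (λ k y → + P * k - + μ * y)
        (trans (tent-suc n e Y) (cong (_+ tent n e Y′) (full-period e Y eP≤Y)))
        (trans (cong +_ (sym (ℕ.m+[n∸m]≡n eP≤Y))) (cong (_+ + Y′) (ℤ.pos-* e P))))
      (cancel (+ P) (+ e) (+ μ) (tent n e Y′) (+ Y′))
  ... | inj₂ Y<eP = ℕ.≤-trans (ℕ.≤-trans (ℤ.∣i-j∣≤∣i∣+∣j∣ (+ P * tent (suc n) e Y) (+ μ * + Y)) (ℕ.+-mono-≤ left right)) (ℕ.≤-reflexive total)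
    where
    partial : ∣ tent (suc n) e Y ∣ ℕ.≤ P ℕ.* (e ℕ.* P)
    partial = subst (λ x → ∣ x ∣ ℕ.≤ P ℕ.* (e ℕ.* P))
      (sym (trans (tent-suc n e Y) (trans (cong (λ x → ∑ P (λ t → g t * + (Y ∸ e ℕ.* t)) + x)
        (trans (cong (tent n e) (ℕ.m≤n⇒m∸n≡0 (ℕ.<⇒≤ Y<eP))) (tent-null n e))) (ℤ.+-identityʳ (∑ P (λ t → g t * + (Y ∸ e ℕ.* t)))))))
      (∣∑∣≤ P (λ t → g t * + (Y ∸ e ℕ.* t)) (e ℕ.* P) (λ t _ →
        ℕ.≤-trans (∣trit*∣≤ (trit t) (+ (Y ∸ e ℕ.* t))) (ℕ.≤-trans (ℕ.m∸n≤m Y (e ℕ.* t)) (ℕ.<⇒≤ Y<eP))))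
    left : ∣ + P * tent (suc n) e Y ∣ ℕ.≤ P ℕ.* (P ℕ.* (e ℕ.* P))
    left = ℕ.≤-trans (ℕ.≤-reflexive (ℤ.abs-* (+ P) (tent (suc n) e Y))) (ℕ.*-monoʳ-≤ P partial)
    right : ∣ + μ * + Y ∣ ℕ.≤ μ ℕ.* (e ℕ.* P)
    right = ℕ.≤-trans (ℕ.≤-reflexive (ℤ.abs-* (+ μ) (+ Y))) (ℕ.*-monoʳ-≤ μ (ℕ.<⇒≤ Y<eP))
    total : P ℕ.* (P ℕ.* (e ℕ.* P)) ℕ.+ μ ℕ.* (e ℕ.* P) ≡ C ℕ.* e
    total = trans (cong₂ (λ x y → P ℕ.* x ℕ.+ μ ℕ.* y) (trans (cong (P ℕ.*_) (ℕ.*-comm e P)) (sym (ℕ.*-assoc P P e))) (ℕ.*-comm e P))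
           (trans (cong₂ ℕ._+_ (sym (ℕ.*-assoc P (P ℕ.* P) e)) (sym (ℕ.*-assoc μ P e))) (sym (ℕ.*-distribʳ-+ e (P ℕ.* (P ℕ.* P)) (μ ℕ.* P))))

-- Dirichlet convolution

δ : ℕ → ℕ → ℤ
δ zero    zero    = 1ℤ
δ zero    (suc n) = 0ℤ
δ (suc m) zero    = 0ℤ
δ (suc m) (suc n) = δ m n

δ-refl : ∀ n → δ n n ≡ 1ℤ
δ-refl zero    = refl
δ-refl (suc n) = δ-refl n

δ-≢ : ∀ {m n} → m ≢ n → δ m n ≡ 0ℤ
δ-≢ {zero}  {zero}  m≢n = contradiction refl m≢n
δ-≢ {zero}  {suc n} m≢n = refl
δ-≢ {suc m} {zero}  m≢n = refl
δ-≢ {suc m} {suc n} m≢n = δ-≢ (m≢n ∘ cong suc)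

δ-guard : ∀ {m n x y} → (m ≡ n → x ≡ y) → δ m n * x ≡ δ m n * y
δ-guard {m} {n} {x} {y} f with m ℕ.≟ n
... | yes m≡n = cong (δ m n *_) (f m≡n)
... | no m≢n  = trans (cong (_* x) (δ-≢ m≢n)) (trans (ℤ.*-zeroˡ x) (sym (trans (cong (_* y) (δ-≢ m≢n)) (ℤ.*-zeroˡ y))))

δ-null : ∀ {m n x} → (m ≡ n → x ≡ 0ℤ) → δ m n * x ≡ 0ℤ
δ-null {m} {n} f = trans (δ-guard f) (ℤ.*-zeroʳ (δ m n))

δ-⇔ : ∀ {m n u v} → (m ≡ n → u ≡ v) → (u ≡ v → m ≡ n) → δ m n ≡ δ u v
δ-⇔ {m} {n} {u} {v} f g with m ℕ.≟ n
... | yes refl with refl ← f refl = trans (δ-refl m) (sym (δ-refl u))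
... | no m≢n   = trans (δ-≢ m≢n) (sym (δ-≢ (m≢n ∘ g)))

∑-δ : ∀ n m (f : ℕ → ℤ) → (n ℕ.≤ m → f m ≡ 0ℤ) → ∑ n (λ i → δ m i * f i) ≡ f m
∑-δ n m f f≡0 with ℕ.≤-<-connex n m
... | inj₁ n≤m = trans (∑-zero n (λ i i<n → δ-null (λ m≡i → contradiction n≤m (ℕ.<⇒≱ (subst (ℕ._< n) (sym m≡i) i<n))))) (sym (f≡0 n≤m))
... | inj₂ m<n = trans (∑-select n (λ i → δ m i * f i) m m<n (λ i i≢m → δ-null (λ m≡i → contradiction (sym m≡i) i≢m)))
                       (trans (cong (_* f m) (δ-refl m)) (ℤ.*-identityˡ (f m)))

-- Insert `δ (q * j) i` and exchange the sums. Since `f` vanishes from `n` on, the range of `j` can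
-- stay `n`.
∑-multiples : ∀ n q f .{{_ : NonZero q}} → (∀ i → ¬ (q ℕ.∣ i) → f i ≡ 0ℤ) → (∀ i → n ℕ.≤ i → f i ≡ 0ℤ) →
              ∑ n f ≡ ∑ n (λ j → f (q ℕ.* j))
∑-multiples n q f off large = begin
  ∑ n f                                              ≡⟨ ∑-cong n expand ⟩
  ∑ n (λ i → ∑ n (λ j → δ (q ℕ.* j) i * f i))        ≡⟨ ∑-comm n n (λ i j → δ (q ℕ.* j) i * f i) ⟩
  ∑ n (λ j → ∑ n (λ i → δ (q ℕ.* j) i * f i))        ≡⟨ ∑-cong n (λ j _ → ∑-δ n (q ℕ.* j) f (large (q ℕ.* j))) ⟩
  ∑ n (λ j → f (q ℕ.* j))                            ∎
  where
  open ≡-Reasoning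
  expand : ∀ i → i ℕ.< n → f i ≡ ∑ n (λ j → δ (q ℕ.* j) i * f i)
  expand i i<n with q ℕ.∣? i
  ... | no q∤i = trans (off i q∤i) (sym (∑-zero n (λ j _ → trans (cong (δ (q ℕ.* j) i *_) (off i q∤i)) (ℤ.*-zeroʳ (δ (q ℕ.* j) i)))))
  ... | yes (ℕ.divides k i≡kq) = sym (trans
      (∑-cong n (λ j _ → cong (_* f i) (δ-⇔ {q ℕ.* j} {i} {k} {j}
        (λ qj≡i → ℕ.*-cancelˡ-≡ k j q (sym (trans qj≡i i≡qk))) (λ k≡j → trans (cong (q ℕ.*_) (sym k≡j)) (sym i≡qk)))))
      (∑-δ n k (λ _ → f i) (λ n≤k → contradiction n≤k (ℕ.<⇒≱ (ℕ.≤-<-trans k≤i i<n)))))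
    where
    i≡qk : i ≡ q ℕ.* k
    i≡qk = trans i≡kq (ℕ.*-comm k q)
    k≤i : k ℕ.≤ i
    k≤i = ℕ.≤-trans (ℕ.m≤m*n k q) (ℕ.≤-reflexive (sym i≡kq))

module Convolution (B : ℕ) where

  -- A delta over a box replaces the list of divisors, so that sums can be exchanged freely. For 0 <
  -- n < B the box contains every factorisation of `n`, and this is the Dirichlet convolution.
  conv : (α β : ℕ → ℤ) → ℕ → ℤ
  conv α β n = ∑ B (λ d → ∑ B (λ e → δ (d ℕ.* e) n * (α d * β e)))

  conv-cong : ∀ {α α′ β β′} n → (∀ d e → d ℕ.* e ≡ n → α d * β e ≡ α′ d * β′ e) → conv α β n ≡ conv α′ β′ n
  conv-cong n eq = ∑-cong B (λ d _ → ∑-cong B (λ e _ → δ-guard (eq d e)))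

  conv-null : ∀ {α β} n → (∀ d e → d ℕ.* e ≡ n → α d * β e ≡ 0ℤ) → conv α β n ≡ 0ℤ
  conv-null n eq = ∑-zero B (λ d _ → ∑-zero B (λ e _ → δ-null (eq d e)))

  conv-+ : ∀ α α′ β n → conv (λ d → α d + α′ d) β n ≡ conv α β n + conv α′ β n
  conv-+ α α′ β n = trans (∑-cong B (λ d _ → trans
      (∑-cong B (λ e _ → distrib (δ (d ℕ.* e) n) (α d) (α′ d) (β e)))
      (∑-+ B (λ e → δ (d ℕ.* e) n * (α d * β e)) (λ e → δ (d ℕ.* e) n * (α′ d * β e)))))
    (∑-+ B (λ d → ∑ B (λ e → δ (d ℕ.* e) n * (α d * β e))) (λ d → ∑ B (λ e → δ (d ℕ.* e) n * (α′ d * β e))))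
    where
    distrib : ∀ w x y z → w * ((x + y) * z) ≡ w * (x * z) + w * (y * z)
    distrib = solve-∀

  conv-comm : ∀ α β n → conv α β n ≡ conv β α n
  conv-comm α β n = trans (∑-comm B B (λ d e → δ (d ℕ.* e) n * (α d * β e)))
    (∑-cong B (λ e _ → ∑-cong B (λ d _ → cong₂ (λ x y → δ x n * y) (ℕ.*-comm d e) (ℤ.*-comm (α d) (β e)))))

  -- Only multiples `q * d` contribute, and `q` then cancels from the condition on the product. The
  -- separate `α′` allows `α` to be cut down to multiples of `q` while `α′` is the full function.
  conv-multiple : ∀ {α α′ β c} q n .{{_ : NonZero q}} .{{_ : NonZero n}} → q ℕ.* n ℕ.< B →
                  (∀ d → α (q ℕ.* d) ≡ c * α′ d) →
                  (∀ d e → d ℕ.* e ≡ q ℕ.* n → ¬ (q ℕ.∣ d) → α d * β e ≡ 0ℤ) →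
                  conv α β (q ℕ.* n) ≡ c * conv α′ β n
  conv-multiple {α} {α′} {β} {c} q n qn<B α-q off = begin
    ∑ B G                                   ≡⟨ ∑-multiples B q G G-off G-large ⟩
    ∑ B (λ d → G (q ℕ.* d))                 ≡⟨ ∑-cong B (λ d _ → trans (∑-cong B (λ e _ → term d e)) (sym (*-distribˡ-∑ B c _))) ⟩
    ∑ B (λ d → c * ∑ B (λ e → δ (d ℕ.* e) n * (α′ d * β e)))   ≡⟨ *-distribˡ-∑ B c _ ⟨
    c * conv α′ β n                         ∎
    where
    open ≡-Reasoning
    G : ℕ → ℤ
    G d = ∑ B (λ e → δ (d ℕ.* e) (q ℕ.* n) * (α d * β e))
    G-off : ∀ d → ¬ (q ℕ.∣ d) → G d ≡ 0ℤ
    G-off d q∤d = ∑-zero B (λ e _ → δ-null (λ de≡qn → off d e de≡qn q∤d))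
    instance
      qn≢0 : NonZero (q ℕ.* n)
      qn≢0 = ℕ.m*n≢0 q n
    G-large : ∀ d → B ℕ.≤ d → G d ≡ 0ℤ
    G-large d B≤d = ∑-zero B (λ e _ → δ-null (λ de≡qn →
      contradiction (ℕ.∣⇒≤ (ℕ.divides e (trans (sym de≡qn) (ℕ.*-comm d e)))) (ℕ.<⇒≱ (ℕ.<-≤-trans qn<B B≤d))))
    swap : ∀ w x y z → w * ((x * y) * z) ≡ x * (w * (y * z))
    swap = solve-∀
    term : ∀ d e → δ (q ℕ.* d ℕ.* e) (q ℕ.* n) * (α (q ℕ.* d) * β e) ≡ c * (δ (d ℕ.* e) n * (α′ d * β e))
    term d e = trans (cong₂ (λ x y → x * (y * β e))
        (δ-⇔ (λ eq → ℕ.*-cancelˡ-≡ (d ℕ.* e) n q (trans (sym (ℕ.*-assoc q d e)) eq))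
             (λ eq → trans (ℕ.*-assoc q d e) (cong (q ℕ.*_) eq)))
        (α-q d))
      (swap (δ (d ℕ.* e) n) c (α′ d) (β e))

-- The coefficients of 1 / ((1 - c x) (1 - g x)).
local : (c g : ℤ) → ℕ → ℤ
local c g zero    = 1ℤ
local c g (suc k) = c * local c g k + g ^ suc k

module CompletelyMultiplicative (B : ℕ) (α β : ℕ → ℤ)
    (α-* : ∀ m n → α (m ℕ.* n) ≡ α m * α n) (β-* : ∀ m n → β (m ℕ.* n) ≡ β m * β n) where
  open Convolution B

  module _ {q : ℕ} (q-prime : Prime q) where
    private
      instance
        q≢0 : NonZero q
        q≢0 = prime⇒nonZero q-prime

      α₀ α₁ : ℕ → ℤ
      α₀ d = if does (q ℕ.∣? d) then 0ℤ else α d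
      α₁ d = if does (q ℕ.∣? d) then α d else 0ℤ

      α₀-∣ : ∀ {d} → q ℕ.∣ d → α₀ d ≡ 0ℤ
      α₀-∣ {d} q∣d with q ℕ.∣? d
      ... | yes _   = refl
      ... | no q∤d  = contradiction q∣d q∤d

      α₀-∤ : ∀ {d} → ¬ (q ℕ.∣ d) → α₀ d ≡ α d
      α₀-∤ {d} q∤d with q ℕ.∣? d
      ... | yes q∣d = contradiction q∣d q∤d
      ... | no _    = refl

      α₁-∣ : ∀ {d} → q ℕ.∣ d → α₁ d ≡ α d
      α₁-∣ {d} q∣d with q ℕ.∣? d
      ... | yes _   = refl
      ... | no q∤d  = contradiction q∣d q∤d

      α₁-∤ : ∀ {d} → ¬ (q ℕ.∣ d) → α₁ d ≡ 0ℤ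
      α₁-∤ {d} q∤d with q ℕ.∣? d
      ... | yes q∣d = contradiction q∣d q∤d
      ... | no _    = refl

      α-split : ∀ d → α d ≡ α₁ d + α₀ d
      α-split d with q ℕ.∣? d
      ... | yes _ = sym (ℤ.+-identityʳ (α d))
      ... | no _  = sym (ℤ.+-identityˡ (α d))

    module _ (m : ℕ) .{{_ : NonZero m}} (q∤m : ¬ (q ℕ.∣ m)) where
      private
        N : ℕ → ℕ
        N k = q ℕ.^ k ℕ.* m

        N-suc : ∀ k → N (suc k) ≡ q ℕ.* N k
        N-suc k = ℕ.*-assoc q (q ℕ.^ k) m

        N≢0 : ∀ k → NonZero (N k)
        N≢0 k = ℕ.m*n≢0 (q ℕ.^ k) m {{ℕ.m^n≢0 q k}}

        N-bound : ∀ k → N (suc k) ℕ.< B → N k ℕ.< B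
        N-bound k lt = ℕ.≤-<-trans (ℕ.m≤n*m (N k) q) (subst (ℕ._< B) (N-suc k) lt)

      -- The part of the convolution at q ^ k * m coming from the divisors d prime to q.
      conv-α₀ : ∀ k → N k ℕ.< B → conv α₀ β (N k) ≡ β q ^ k * conv α β m
      conv-α₀ zero    _ = trans (trans (cong (conv α₀ β) (ℕ.*-identityˡ m))
        (conv-cong {α₀} {α} {β} {β} m (λ d e de≡m → cong (_* β e) (α₀-∤ (λ q∣d → q∤m (ℕ.∣-trans q∣d (ℕ.divides e (trans (sym de≡m) (ℕ.*-comm d e)))))))))
        (sym (ℤ.*-identityˡ (conv α β m)))
      conv-α₀ (suc k) lt = begin
        conv α₀ β (N (suc k))           ≡⟨ cong (conv α₀ β) (N-suc k) ⟩
        conv α₀ β (q ℕ.* N k)           ≡⟨ conv-comm α₀ β (q ℕ.* N k) ⟩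
        conv β α₀ (q ℕ.* N k)           ≡⟨ conv-multiple {β} {β} {α₀} {β q} q (N k) {{q≢0}} {{N≢0 k}} (subst (ℕ._< B) (N-suc k) lt) (β-* q) off ⟩
        β q * conv β α₀ (N k)           ≡⟨ cong (β q *_) (conv-comm β α₀ (N k)) ⟩
        β q * conv α₀ β (N k)           ≡⟨ cong (β q *_) (conv-α₀ k (N-bound k lt)) ⟩
        β q * (β q ^ k * conv α β m)    ≡⟨ ℤ.*-assoc (β q) (β q ^ k) (conv α β m) ⟨
        β q ^ suc k * conv α β m        ∎
        where
        open ≡-Reasoning
        off : ∀ d e → d ℕ.* e ≡ q ℕ.* N k → ¬ (q ℕ.∣ d) → β d * α₀ e ≡ 0ℤ
        off d e de≡ q∤d = trans (cong (β d *_) (α₀-∣ ([ (λ q∣d → contradiction q∣d q∤d) , id ]′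
          (euclidsLemma d e q-prime (ℕ.divides (N k) (trans de≡ (ℕ.*-comm q (N k)))))))) (ℤ.*-zeroʳ (β d))

      -- Sorting the divisors by whether `q` divides them gives f(q^(k+1) m) = α(q) f(q^k m) +
      -- β(q)^(k+1) f(m), the recursion that defines `local`.
      conv-prime-power : ∀ k → N k ℕ.< B → conv α β (N k) ≡ local (α q) (β q) k * conv α β m
      conv-prime-power zero    _ = trans (cong (conv α β) (ℕ.*-identityˡ m)) (sym (ℤ.*-identityˡ (conv α β m)))
      conv-prime-power (suc k) lt = begin
        conv α β (N (suc k))
          ≡⟨ conv-cong {α} {λ d → α₁ d + α₀ d} {β} {β} (N (suc k)) (λ d e _ → cong (_* β e) (α-split d)) ⟩
        conv (λ d → α₁ d + α₀ d) β (N (suc k))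
          ≡⟨ conv-+ α₁ α₀ β (N (suc k)) ⟩
        conv α₁ β (N (suc k)) + conv α₀ β (N (suc k))
          ≡⟨ cong₂ _+_ (trans (cong (conv α₁ β) (N-suc k))
                              (conv-multiple {α₁} {α} {β} {α q} q (N k) {{q≢0}} {{N≢0 k}} (subst (ℕ._< B) (N-suc k) lt) α₁-q off))
                       (conv-α₀ (suc k) lt) ⟩
        α q * conv α β (N k) + β q ^ suc k * M
          ≡⟨ cong (λ x → α q * x + β q ^ suc k * M) (conv-prime-power k (N-bound k lt)) ⟩
        α q * (local (α q) (β q) k * M) + β q ^ suc k * M
          ≡⟨ factor (α q) (local (α q) (β q) k) M (β q ^ suc k) ⟩
        local (α q) (β q) (suc k) * M ∎
        where
        open ≡-Reasoning
        M = conv α β m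
        factor : ∀ a l m b → a * (l * m) + b * m ≡ (a * l + b) * m
        factor = solve-∀
        α₁-q : ∀ d → α₁ (q ℕ.* d) ≡ α q * α d
        α₁-q d = trans (α₁-∣ (ℕ.m∣m*n d)) (α-* q d)
        off : ∀ d e → d ℕ.* e ≡ q ℕ.* N k → ¬ (q ℕ.∣ d) → α₁ d * β e ≡ 0ℤ
        off d e _ q∤d = trans (cong (_* β e) (α₁-∤ q∤d)) (ℤ.*-zeroˡ (β e))

-- Local factors and positivity of the convolution

data Favourable (c g : ℤ) : Set where
  first  : c ≡ 1ℤ → Trit g → Favourable c g
  second : c ≡ -1ℤ → g ≡ 1ℤ → Favourable c g

-- The sequence 1, 0, 1, 0, ... of coefficients of 1 / (1 - x²), which arises when the two character
-- values are 1 and -1 in either order.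
module Alternating (l : ℕ → ℤ) (l₀ : l 0 ≡ 1ℤ) (l₁ : l 1 ≡ 0ℤ) (l₂ : ∀ k → l (suc (suc k)) ≡ l k) where
  nonneg : ∀ k → 0ℤ ℤ.≤ l k
  nonneg 0             = subst (0ℤ ℤ.≤_) (sym l₀) (ℤ.+≤+ z≤n)
  nonneg 1             = subst (0ℤ ℤ.≤_) (sym l₁) (ℤ.+≤+ z≤n)
  nonneg (suc (suc k)) = subst (0ℤ ℤ.≤_) (sym (l₂ k)) (nonneg k)

  even : ∀ j → l (j ℕ.+ j) ≡ 1ℤ
  even zero    = l₀
  even (suc j) = trans (cong (l ∘ suc) (ℕ.+-suc j j)) (trans (l₂ (j ℕ.+ j)) (even j))

0^suc : ∀ k → 0ℤ ^ suc k ≡ 0ℤ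
0^suc k = ℤ.*-zeroˡ (0ℤ ^ k)

local-1-0 : ∀ k → local 1ℤ 0ℤ k ≡ 1ℤ
local-1-0 zero    = refl
local-1-0 (suc k) = cong₂ (λ x y → 1ℤ * x + y) (local-1-0 k) (0^suc k)

local-1-1 : ∀ k → 1ℤ ℤ.≤ local 1ℤ 1ℤ k
local-1-1 zero    = ℤ.≤-refl
local-1-1 (suc k) = ℤ.≤-trans (local-1-1 k) (ℤ.≤-trans (ℤ.i≤i+j (local 1ℤ 1ℤ k) 1ℤ)
  (ℤ.≤-reflexive (sym (cong₂ _+_ (ℤ.*-identityˡ (local 1ℤ 1ℤ k)) (ℤ.^-zeroˡ (suc k))))))

-- The generating functions are 1 / (1 - x), 1 / (1 - x)² and 1 / (1 - x²). Only the last has zero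
-- coefficients, and those are at odd exponents.
local-positive : ∀ {c g} → Favourable c g → (∀ k → 0ℤ ℤ.≤ local c g k) × (∀ j → 1ℤ ℤ.≤ local c g (j ℕ.+ j))
local-positive (first refl (null refl)) =
  (λ k → ℤ.≤-trans (ℤ.+≤+ z≤n) (ℤ.≤-reflexive (sym (local-1-0 k)))) , (λ j → ℤ.≤-reflexive (sym (local-1-0 (j ℕ.+ j))))
local-positive (first refl (plus refl)) =
  (λ k → ℤ.≤-trans (ℤ.+≤+ z≤n) (local-1-1 k)) , (λ j → local-1-1 (j ℕ.+ j))
local-positive (first refl (minus refl)) = nonneg , (λ j → ℤ.≤-reflexive (sym (even j)))
  where
  eq : ∀ l s → 1ℤ * (1ℤ * l + s) + -1ℤ * s ≡ l
  eq = solve-∀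
  open Alternating (local 1ℤ -1ℤ) refl refl (λ k → eq (local 1ℤ -1ℤ k) (-1ℤ ^ suc k))
local-positive (second refl refl) = nonneg , (λ j → ℤ.≤-reflexive (sym (even j)))
  where
  eq : ∀ l s → -1ℤ * (-1ℤ * l + s) + 1ℤ * s ≡ l
  eq = solve-∀
  open Alternating (local -1ℤ 1ℤ) refl refl (λ k → eq (local -1ℤ 1ℤ k) (1ℤ ^ suc k))

-- The factor at the prime 2, where both characters vanish.
local-null : ∀ k → 0ℤ ℤ.≤ local 0ℤ 0ℤ k
local-null zero    = ℤ.+≤+ z≤n
local-null (suc k) = ℤ.≤-reflexive (sym (cong₂ _+_ (ℤ.*-zeroˡ (local 0ℤ 0ℤ k)) (0^suc k)))

*-nonneg : ∀ {i j} → 0ℤ ℤ.≤ i → 0ℤ ℤ.≤ j → 0ℤ ℤ.≤ i * j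
*-nonneg {+ m} {+ n} _ _ = subst (0ℤ ℤ.≤_) (ℤ.pos-* m n) (ℤ.+≤+ z≤n)

*-positive : ∀ {i j} → 1ℤ ℤ.≤ i → 1ℤ ℤ.≤ j → 1ℤ ℤ.≤ i * j
*-positive {+ m} {+ n} (ℤ.+≤+ 1≤m) (ℤ.+≤+ 1≤n) = subst (1ℤ ℤ.≤_) (ℤ.pos-* m n) (ℤ.+≤+ (ℕ.*-mono-≤ 1≤m 1≤n))

primeDivisor : ∀ n → 1 ℕ.< n → ∃[ q ] Prime q × q ℕ.∣ n
primeDivisor n 1<n with factorise n {{ℕ.>-nonZero (ℕ.<-trans z<s 1<n)}}
... | record { factors = [] ; isFactorisation = n≡1 } = contradiction n≡1 (ℕ.>⇒≢ 1<n)
... | record { factors = q ∷ qs ; isFactorisation = n≡ ; factorsPrime = q-prime ∷ _ } =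
  q , q-prime , subst (q ℕ.∣_) (sym n≡) (ℕ.m∣m*n _)

record Valuation (q n : ℕ) : Set where
  constructor valuation
  field
    exponent cofactor : ℕ
    factorisation : n ≡ q ℕ.^ exponent ℕ.* cofactor
    coprime : ¬ (q ℕ.∣ cofactor)

valuate : ∀ q → 1 ℕ.< q → ∀ n → 0 ℕ.< n → Valuation q n
valuate q 1<q = <-rec (λ n → 0 ℕ.< n → Valuation q n) λ n rec 0<n → extract n rec 0<n (q ℕ.∣? n)
  where
  extract : ∀ n → (∀ {m} → m ℕ.< n → 0 ℕ.< m → Valuation q m) → 0 ℕ.< n → Dec (q ℕ.∣ n) → Valuation q n
  extract n rec 0<n (no q∤n) = valuation 0 n (sym (ℕ.*-identityˡ n)) q∤n
  extract n rec 0<n (yes (ℕ.divides m n≡mq)) with rec m<n 0<m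
    where
    0<m : 0 ℕ.< m
    0<m = ℕ.n≢0⇒n>0 λ { refl → ℕ.>⇒≢ 0<n n≡mq }
    m<n : m ℕ.< n
    m<n = subst (m ℕ.<_) (sym n≡mq) (ℕ.m<m*n m q {{ℕ.>-nonZero 0<m}} 1<q)
  ... | valuation k c m≡ q∤c = valuation (suc k) c
    (trans n≡mq (trans (cong (ℕ._* q) m≡) (trans (ℕ.*-comm _ q) (sym (ℕ.*-assoc q (q ℕ.^ k) c))))) q∤c

-- The whole power of one prime is peeled off; `m<n` drives the strong inductions below.
record Split (n : ℕ) : Set where
  field
    q k m : ℕ
    q-prime : Prime q
    q∣n : q ℕ.∣ n
    n≡ : n ≡ q ℕ.^ k ℕ.* m
    q∤m : ¬ (q ℕ.∣ m)
    m<n : m ℕ.< n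
    0<m : 0 ℕ.< m

split : ∀ n → 1 ℕ.< n → Split n
split n 1<n with primeDivisor n 1<n
... | q , q-prime , q∣n with valuate q (ℕ.nonTrivial⇒n>1 q {{prime⇒nonTrivial q-prime}}) n (ℕ.<-trans z<s 1<n)
... | valuation zero    m n≡ q∤m = contradiction (subst (q ℕ.∣_) (trans n≡ (ℕ.*-identityˡ m)) q∣n) q∤m
... | valuation (suc k) m n≡ q∤m = record
  { q = q ; k = suc k ; m = m ; q-prime = q-prime ; q∣n = q∣n ; n≡ = n≡ ; q∤m = q∤m ; m<n = m<n ; 0<m = 0<m }
  where
  1<q : 1 ℕ.< q
  1<q = ℕ.nonTrivial⇒n>1 q {{prime⇒nonTrivial q-prime}}
  0<m : 0 ℕ.< m
  0<m = ℕ.n≢0⇒n>0 λ { refl → q∤m (q ℕ.∣0) }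
  instance
    q≢0 : NonZero q
    q≢0 = prime⇒nonZero q-prime
  m<n : m ℕ.< n
  m<n = subst (m ℕ.<_) (trans (ℕ.*-comm m (q ℕ.^ suc k)) (sym n≡))
    (ℕ.m<m*n m (q ℕ.^ suc k) {{ℕ.>-nonZero 0<m}} (ℕ.<-≤-trans 1<q (ℕ.m≤m*n q (q ℕ.^ k) {{ℕ.m^n≢0 q k}})))

module Positivity (B : ℕ) (α β : ℕ → ℤ)
    (α-* : ∀ m n → α (m ℕ.* n) ≡ α m * α n) (β-* : ∀ m n → β (m ℕ.* n) ≡ β m * β n)
    (α-1 : α 1 ≡ 1ℤ) (β-1 : β 1 ≡ 1ℤ) (α-2 : α 2 ≡ 0ℤ) (β-2 : β 2 ≡ 0ℤ)
    (favourable : ∀ q → Prime q → q ℕ.< B → q ≢ 2 → Favourable (α q) (β q)) where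
  open Convolution B
  open CompletelyMultiplicative B α β α-* β-*

  conv-1 : 1 ℕ.< B → conv α β 1 ≡ 1ℤ
  conv-1 1<B = begin
    conv α β 1
      ≡⟨ ∑-select B (λ d → ∑ B (λ e → δ (d ℕ.* e) 1 * (α d * β e))) 1 1<B
           (λ d d≢1 → ∑-zero B (λ e _ → δ-null (λ de≡1 → contradiction (ℕ.m*n≡1⇒m≡1 d e de≡1) d≢1))) ⟩
    ∑ B (λ e → δ (1 ℕ.* e) 1 * (α 1 * β e))
      ≡⟨ ∑-select B (λ e → δ (1 ℕ.* e) 1 * (α 1 * β e)) 1 1<B
           (λ e e≢1 → δ-null (λ eq → contradiction (trans (sym (ℕ.*-identityˡ e)) eq) e≢1)) ⟩
    1ℤ * (α 1 * β 1)     ≡⟨ cong₂ (λ x y → 1ℤ * (x * y)) α-1 β-1 ⟩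
    1ℤ                   ∎
    where open ≡-Reasoning

  local-nonneg : ∀ q → Prime q → q ℕ.< B → ∀ k → 0ℤ ℤ.≤ local (α q) (β q) k
  local-nonneg q q-prime q<B k with q ℕ.≟ 2
  ... | yes refl = subst (0ℤ ℤ.≤_) (sym (cong₂ (λ x y → local x y k) α-2 β-2)) (local-null k)
  ... | no q≢2   = proj₁ (local-positive (favourable q q-prime q<B q≢2)) k

  conv-nonneg : ∀ n → 0 ℕ.< n → n ℕ.< B → 0ℤ ℤ.≤ conv α β n
  conv-nonneg = <-rec (λ n → 0 ℕ.< n → n ℕ.< B → 0ℤ ℤ.≤ conv α β n) induct
    where
    induct : ∀ n → (∀ {m} → m ℕ.< n → 0 ℕ.< m → m ℕ.< B → 0ℤ ℤ.≤ conv α β m) → 0 ℕ.< n → n ℕ.< B → 0ℤ ℤ.≤ conv α β n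
    induct 1 _ _ 1<B = subst (0ℤ ℤ.≤_) (sym (conv-1 1<B)) (ℤ.+≤+ z≤n)
    induct n@(suc (suc _)) rec _ n<B = subst (0ℤ ℤ.≤_)
      (sym (trans (cong (conv α β) n≡) (conv-prime-power q-prime m {{ℕ.>-nonZero 0<m}} q∤m k (subst (ℕ._< B) n≡ n<B))))
      (*-nonneg (local-nonneg q q-prime (ℕ.≤-<-trans (ℕ.∣⇒≤ q∣n) n<B) k) (rec m<n 0<m (ℕ.<-trans m<n n<B)))
      where open Split (split n (s<s z<s))

  -- In a square every prime has an even exponent, where its local factor is at least 1. Oddness
  -- keeps out the prime 2, whose factor is 0 at positive exponents.
  conv-square : ∀ r → 0 ℕ.< r → ¬ (2 ℕ.∣ r) → r ℕ.* r ℕ.< B → 1ℤ ℤ.≤ conv α β (r ℕ.* r)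
  conv-square = <-rec (λ r → 0 ℕ.< r → ¬ (2 ℕ.∣ r) → r ℕ.* r ℕ.< B → 1ℤ ℤ.≤ conv α β (r ℕ.* r)) induct
    where
    induct : ∀ r → (∀ {m} → m ℕ.< r → 0 ℕ.< m → ¬ (2 ℕ.∣ m) → m ℕ.* m ℕ.< B → 1ℤ ℤ.≤ conv α β (m ℕ.* m)) →
           0 ℕ.< r → ¬ (2 ℕ.∣ r) → r ℕ.* r ℕ.< B → 1ℤ ℤ.≤ conv α β (r ℕ.* r)
    induct 1 _ _ _ 1<B = ℤ.≤-reflexive (sym (conv-1 1<B))
    induct r@(suc (suc _)) rec _ 2∤r r²<B = subst (1ℤ ℤ.≤_)
      (sym (trans (cong (conv α β) r²≡) (conv-prime-power q-prime (m ℕ.* m) {{ℕ.>-nonZero (ℕ.*-mono-≤ 0<m 0<m)}} q∤m² (k ℕ.+ k)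
        (subst (ℕ._< B) r²≡ r²<B))))
      (*-positive (proj₂ (local-positive (favourable q q-prime q<B (λ q≡2 → 2∤r (subst (ℕ._∣ r) q≡2 q∣n)))) k)
                  (rec m<n 0<m (λ 2∣m → 2∤r (subst (2 ℕ.∣_) (sym n≡) (ℕ.∣n⇒∣m*n (q ℕ.^ k) 2∣m)))
                    (ℕ.<-trans (ℕ.*-mono-< m<n m<n) r²<B)))
      where
      open Split (split r (s<s z<s))
      q<B : q ℕ.< B
      q<B = ℕ.≤-<-trans (ℕ.≤-trans (ℕ.∣⇒≤ q∣n) (ℕ.m≤m*n r r)) r²<B
      q∤m² : ¬ (q ℕ.∣ m ℕ.* m)
      q∤m² d = [ q∤m , q∤m ]′ (euclidsLemma m m q-prime d)
      swap : ∀ x m → (x ℕ.* m) ℕ.* (x ℕ.* m) ≡ (x ℕ.* x) ℕ.* (m ℕ.* m)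
      swap x m = ℕ.[m*n]*[o*p]≡[m*o]*[n*p] x m x m
      r²≡ : r ℕ.* r ≡ q ℕ.^ (k ℕ.+ k) ℕ.* (m ℕ.* m)
      r²≡ = trans (cong₂ ℕ._*_ n≡ n≡) (trans (swap (q ℕ.^ k) m) (cong (ℕ._* (m ℕ.* m)) (sym (ℕ.^-distribˡ-+-* q k k))))

-- Comparison of sums and regrouping by products

∑-≤ : ∀ n {f g : ℕ → ℤ} → (∀ i → i ℕ.< n → f i ℤ.≤ g i) → ∑ n f ℤ.≤ ∑ n g
∑-≤ zero    f≤g = ℤ.≤-refl
∑-≤ (suc n) f≤g = ℤ.+-mono-≤ (f≤g 0 z<s) (∑-≤ n (λ i i<n → f≤g (suc i) (s<s i<n)))

∑-const : ∀ n c → ∑ n (λ _ → + c) ≡ + (n ℕ.* c)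
∑-const zero    c = refl
∑-const (suc n) c = cong (λ x → + c + x) (∑-const n c)

∑-extend : ∀ m n (f : ℕ → ℤ) → m ℕ.≤ n → (∀ i → i ℕ.< n → 0ℤ ℤ.≤ f i) → ∑ m f ℤ.≤ ∑ n f
∑-extend zero    n       f _         f≥0 = ℤ.≤-trans (ℤ.≤-reflexive (sym (∑-zero n (λ _ _ → refl)))) (∑-≤ n f≥0)
∑-extend (suc m) (suc n) f (s≤s m≤n) f≥0 = ℤ.+-monoʳ-≤ (f 0) (∑-extend m n (f ∘ suc) m≤n (λ i i<n → f≥0 (suc i) (s<s i<n)))

-- Split off the last selected term: the earlier ones lie below `s k`, which becomes the new range.
∑-sparse : ∀ k n (f : ℕ → ℤ) (s : ℕ → ℕ) → (∀ {i j} → i ℕ.< j → s i ℕ.< s j) → (∀ i → i ℕ.< k → s i ℕ.< n) →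
           (∀ i → i ℕ.< n → 0ℤ ℤ.≤ f i) → ∑ k (f ∘ s) ℤ.≤ ∑ n f
∑-sparse zero    n f s mono s<n f≥0 = ∑-extend 0 n f z≤n f≥0
∑-sparse (suc k) n f s mono s<n f≥0 = ℤ.≤-trans (ℤ.≤-reflexive (∑-suc k (f ∘ s)))
  (ℤ.≤-trans (ℤ.+-monoˡ-≤ (f (s k)) (∑-sparse k (s k) f s mono (λ i → mono) (λ i i<sk → f≥0 i (ℕ.<-trans i<sk (s<n k (ℕ.n<1+n k))))))
  (ℤ.≤-trans (ℤ.≤-reflexive (sym (∑-suc (s k) f))) (∑-extend (suc (s k)) n f (s<n k (ℕ.n<1+n k)) f≥0)))

tentSum : (α β : ℕ → ℤ) → ℕ → ℤ
tentSum α β X = ∑ X (λ d → ∑ X (λ e → α d * β e * + (X ∸ d ℕ.* e)))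

-- Pairs are grouped by their product; a pair with product at least `X` has weight 0, so no group is
-- lost.
tentSum-conv : ∀ α β X → tentSum α β X ≡ ∑ X (λ n → + (X ∸ n) * Convolution.conv X α β n)
tentSum-conv α β X = begin
  ∑ X (λ d → ∑ X (λ e → α d * β e * + (X ∸ d ℕ.* e)))
    ≡⟨ ∑-cong X (λ d _ → ∑-cong X (λ e _ → expand d e)) ⟩
  ∑ X (λ d → ∑ X (λ e → ∑ X (λ n → term d e n)))
    ≡⟨ ∑-cong X (λ d _ → ∑-comm X X (λ e n → term d e n)) ⟩
  ∑ X (λ d → ∑ X (λ n → ∑ X (λ e → term d e n)))
    ≡⟨ ∑-comm X X (λ d n → ∑ X (λ e → term d e n)) ⟩
  ∑ X (λ n → ∑ X (λ d → ∑ X (λ e → term d e n)))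
    ≡⟨ ∑-cong X (λ n _ → trans (∑-cong X (λ d _ → sym (*-distribˡ-∑ X (+ (X ∸ n)) (λ e → δ (d ℕ.* e) n * (α d * β e)))))
                               (sym (*-distribˡ-∑ X (+ (X ∸ n)) (λ d → ∑ X (λ e → δ (d ℕ.* e) n * (α d * β e)))))) ⟩
  ∑ X (λ n → + (X ∸ n) * Convolution.conv X α β n) ∎
  where
  open ≡-Reasoning
  term : ℕ → ℕ → ℕ → ℤ
  term d e n = + (X ∸ n) * (δ (d ℕ.* e) n * (α d * β e))
  swap : ∀ w x y → w * (x * y) ≡ y * (x * w)
  swap = solve-∀
  expand : ∀ d e → α d * β e * + (X ∸ d ℕ.* e) ≡ ∑ X (term d e)
  expand d e = begin
    α d * β e * + (X ∸ d ℕ.* e)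
      ≡⟨ cong (α d * β e *_) (∑-δ X (d ℕ.* e) (λ n → + (X ∸ n)) (λ X≤de → cong +_ (ℕ.m≤n⇒m∸n≡0 X≤de))) ⟨
    α d * β e * ∑ X (λ n → δ (d ℕ.* e) n * + (X ∸ n))
      ≡⟨ *-distribˡ-∑ X (α d * β e) (λ n → δ (d ℕ.* e) n * + (X ∸ n)) ⟩
    ∑ X (λ n → α d * β e * (δ (d ℕ.* e) n * + (X ∸ n)))
      ≡⟨ ∑-cong X (λ n _ → swap (α d * β e) (δ (d ℕ.* e) n) (+ (X ∸ n))) ⟩
    ∑ X (term d e) ∎

-- The hyperbola method

module UpperBound (P : ℕ) (β : ℕ → ℤ) (trit-β : ∀ t → Trit (β t)) (β-per : ∀ t → β (P ℕ.+ t) ≡ β t)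
                  (∑β≡0 : ∑ P β ≡ 0ℤ) (∑tβ≡0 : ∑ P (λ t → + t * β t) ≡ 0ℤ) (β-0 : β 0 ≡ 0ℤ)
                  (M n N : ℕ) (E≡nP : suc M ≡ n ℕ.* P) (X≡4N : suc M ℕ.* suc M ≡ N ℕ.* 4) where
  private
    E X : ℕ
    E = suc M
    X = E ℕ.* E

    module A = TentSum 4 χ₄ 2 trit-χ₄ (λ t → refl) refl refl
    module B = TentSum P β 0 trit-β β-per ∑β≡0 ∑tβ≡0

    H J : ℕ → ℤ
    H e = ∑ X (λ d → χ₄ d * + (X ∸ e ℕ.* d))
    J d = ∑ (M ℕ.* E) (λ t → β (E ℕ.+ t) * + (X ∸ d ℕ.* (E ℕ.+ t)))

    S₁ S₂ : ℤ
    S₁ = ∑ E (λ e → β e * H e)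
    S₂ = ∑ E (λ d → χ₄ d * J d)

    H-tent : ∀ e → H e ≡ A.tent N e X
    H-tent e = cong (λ k → ∑ k (λ d → χ₄ d * + (X ∸ e ℕ.* d))) X≡4N

    J-tent : ∀ d → J d ≡ B.tent (M ℕ.* n) d (X ∸ d ℕ.* E)
    J-tent d = trans (cong (λ k → ∑ k (λ t → β (E ℕ.+ t) * + (X ∸ d ℕ.* (E ℕ.+ t)))) (trans (cong (M ℕ.*_) E≡nP) (sym (ℕ.*-assoc M n P))))
      (∑-cong (M ℕ.* n ℕ.* P) (λ t _ → cong₂ (λ x y → x * + y)
        (trans (cong (λ e → β (e ℕ.+ t)) E≡nP) (periodic P β β-per n t))
        (trans (cong (X ∸_) (ℕ.*-distribˡ-+ d E t)) (sym (ℕ.∸-+-assoc X (d ℕ.* E) (d ℕ.* t))))))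

    J-null : ∀ d → E ℕ.≤ d → J d ≡ 0ℤ
    J-null d E≤d = trans (J-tent d) (trans (cong (B.tent (M ℕ.* n) d) (ℕ.m≤n⇒m∸n≡0 (ℕ.*-monoˡ-≤ E E≤d))) (B.tent-null (M ℕ.* n) d))

    -- `S₁` collects e < E. If d and e are both at least `E` then d e ≥ X and the weight is 0, so
    -- the remaining pairs have d < E and form `S₂`. The length `M * E` of the tail is X - E.
    tentSum-split : tentSum χ₄ β X ≡ S₁ + S₂
    tentSum-split = begin
      tentSum χ₄ β X
        ≡⟨ ∑-comm X X (λ d e → χ₄ d * β e * + (X ∸ d ℕ.* e)) ⟩
      ∑ X (λ e → ∑ X (λ d → χ₄ d * β e * + (X ∸ d ℕ.* e)))
        ≡⟨ ∑-cong X (λ e _ → trans (∑-cong X (λ d _ → trans (swap (χ₄ d) (β e) (+ (X ∸ d ℕ.* e))) (cong (λ x → β e * (χ₄ d * + (X ∸ x))) (ℕ.*-comm d e))))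
                                   (sym (*-distribˡ-∑ X (β e) (λ d → χ₄ d * + (X ∸ e ℕ.* d))))) ⟩
      ∑ X (λ e → β e * H e)
        ≡⟨ ∑-split E (M ℕ.* E) (λ e → β e * H e) ⟩
      S₁ + ∑ (M ℕ.* E) (λ t → β (E ℕ.+ t) * H (E ℕ.+ t))
        ≡⟨ cong (λ x → S₁ + x) tail ⟩
      S₁ + S₂ ∎
      where
      open ≡-Reasoning
      swap : ∀ x y z → x * y * z ≡ y * (x * z)
      swap = solve-∀
      flip : ∀ x y z → x * (y * z) ≡ y * (x * z)
      flip = solve-∀
      tail : ∑ (M ℕ.* E) (λ t → β (E ℕ.+ t) * H (E ℕ.+ t)) ≡ S₂
      tail = begin
        ∑ (M ℕ.* E) (λ t → β (E ℕ.+ t) * H (E ℕ.+ t))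
          ≡⟨ ∑-cong (M ℕ.* E) (λ t _ → trans (*-distribˡ-∑ X (β (E ℕ.+ t)) (λ d → χ₄ d * + (X ∸ (E ℕ.+ t) ℕ.* d)))
               (∑-cong X (λ d _ → trans (flip (β (E ℕ.+ t)) (χ₄ d) (+ (X ∸ (E ℕ.+ t) ℕ.* d)))
                 (cong (λ x → χ₄ d * (β (E ℕ.+ t) * + (X ∸ x))) (ℕ.*-comm (E ℕ.+ t) d))))) ⟩
        ∑ (M ℕ.* E) (λ t → ∑ X (λ d → χ₄ d * (β (E ℕ.+ t) * + (X ∸ d ℕ.* (E ℕ.+ t)))))
          ≡⟨ ∑-comm (M ℕ.* E) X (λ t d → χ₄ d * (β (E ℕ.+ t) * + (X ∸ d ℕ.* (E ℕ.+ t)))) ⟩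
        ∑ X (λ d → ∑ (M ℕ.* E) (λ t → χ₄ d * (β (E ℕ.+ t) * + (X ∸ d ℕ.* (E ℕ.+ t)))))
          ≡⟨ ∑-cong X (λ d _ → sym (*-distribˡ-∑ (M ℕ.* E) (χ₄ d) (λ t → β (E ℕ.+ t) * + (X ∸ d ℕ.* (E ℕ.+ t))))) ⟩
        ∑ X (λ d → χ₄ d * J d)
          ≡⟨ ∑-split E (M ℕ.* E) (λ d → χ₄ d * J d) ⟩
        S₂ + ∑ (M ℕ.* E) (λ t → χ₄ (E ℕ.+ t) * J (E ℕ.+ t))
          ≡⟨ cong (λ x → S₂ + x) (∑-zero (M ℕ.* E) (λ t _ → trans (cong (χ₄ (E ℕ.+ t) *_) (J-null (E ℕ.+ t) (ℕ.m≤m+n E t))) (ℤ.*-zeroʳ (χ₄ (E ℕ.+ t))))) ⟩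
        S₂ + 0ℤ
          ≡⟨ ℤ.+-identityʳ S₂ ⟩
        S₂ ∎

    -- The inner sum satisfies 4 H(e) = 2 X up to 72 e. The centre does not depend on `e`, and `E`
    -- is a multiple of `P`, so it sums to 0 against `β`; there remain `E` errors of at most 72 E.
    S₁-bound : ∣ + 4 * S₁ ∣ ℕ.≤ E ℕ.* (72 ℕ.* E)
    S₁-bound = subst (λ x → ∣ x ∣ ℕ.≤ E ℕ.* (72 ℕ.* E)) (sym centred)
      (∣∑∣≤ E (λ e → β e * (+ 4 * H e - + 2 * + X)) (72 ℕ.* E) bound)
      where
      open ≡-Reasoning
      recentre : ∀ b h x → + 4 * (b * h) ≡ b * (+ 4 * h - x) + x * b
      recentre = solve-∀
      centred : + 4 * S₁ ≡ ∑ E (λ e → β e * (+ 4 * H e - + 2 * + X))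
      centred = begin
        + 4 * S₁
          ≡⟨ *-distribˡ-∑ E (+ 4) (λ e → β e * H e) ⟩
        ∑ E (λ e → + 4 * (β e * H e))
          ≡⟨ ∑-cong E (λ e _ → recentre (β e) (H e) (+ 2 * + X)) ⟩
        ∑ E (λ e → β e * (+ 4 * H e - + 2 * + X) + + 2 * + X * β e)
          ≡⟨ ∑-+ E (λ e → β e * (+ 4 * H e - + 2 * + X)) (λ e → + 2 * + X * β e) ⟩
        ∑ E (λ e → β e * (+ 4 * H e - + 2 * + X)) + ∑ E (λ e → + 2 * + X * β e)
          ≡⟨ cong (λ x → ∑ E (λ e → β e * (+ 4 * H e - + 2 * + X)) + x)
               (trans (sym (*-distribˡ-∑ E (+ 2 * + X) β))
                 (trans (cong (+ 2 * + X *_) (trans (cong (λ k → ∑ k β) E≡nP) (∑-periodic P β β-per ∑β≡0 n))) (ℤ.*-zeroʳ (+ 2 * + X)))) ⟩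
        ∑ E (λ e → β e * (+ 4 * H e - + 2 * + X)) + 0ℤ
          ≡⟨ ℤ.+-identityʳ _ ⟩
        ∑ E (λ e → β e * (+ 4 * H e - + 2 * + X)) ∎
      bound : ∀ e → e ℕ.< E → ∣ β e * (+ 4 * H e - + 2 * + X) ∣ ℕ.≤ 72 ℕ.* E
      -- At e = 0 the weight never decays and `tent-bound` does not apply, but `β 0` is 0.
      bound zero _ = subst (λ x → ∣ x ∣ ℕ.≤ 72 ℕ.* E)
        (sym (trans (cong (_* (+ 4 * H 0 - + 2 * + X)) β-0) (ℤ.*-zeroˡ (+ 4 * H 0 - + 2 * + X)))) z≤n
      bound e@(suc _) e<E = ℕ.≤-trans (∣trit*∣≤ (trit-β e) (+ 4 * H e - + 2 * + X))
        (ℕ.≤-trans (subst (λ x → ∣ + 4 * x - + 2 * + X ∣ ℕ.≤ 72 ℕ.* e) (sym (H-tent e))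
                     (A.tent-bound N e X (ℕ.≤-trans (ℕ.≤-reflexive X≡4N) (ℕ.m≤n*m (N ℕ.* 4) e))))
                   (ℕ.*-monoʳ-≤ 72 (ℕ.<⇒≤ e<E)))

    -- The first moment of `β` is 0, so the inner sums have no main term and need no centring.
    S₂-bound : ∣ + P * S₂ ∣ ℕ.≤ E ℕ.* (B.C ℕ.* E)
    S₂-bound = subst (λ x → ∣ x ∣ ℕ.≤ E ℕ.* (B.C ℕ.* E)) (sym (*-distribˡ-∑ E (+ P) (λ d → χ₄ d * J d)))
      (∣∑∣≤ E (λ d → + P * (χ₄ d * J d)) (B.C ℕ.* E) bound)
      where
      flip : ∀ x y z → x * (y * z) ≡ y * (x * z)
      flip = solve-∀
      drop : ∀ x y → x - 0ℤ * y ≡ x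
      drop = solve-∀
      bound : ∀ d → d ℕ.< E → ∣ + P * (χ₄ d * J d) ∣ ℕ.≤ B.C ℕ.* E
      bound zero _ = subst (λ x → ∣ x ∣ ℕ.≤ B.C ℕ.* E)
        (sym (trans (cong (+ P *_) (ℤ.*-zeroˡ (J 0))) (ℤ.*-zeroʳ (+ P)))) z≤n
      bound d@(suc d′) d<E = subst (λ x → ∣ x ∣ ℕ.≤ B.C ℕ.* E) (sym (flip (+ P) (χ₄ d) (J d)))
        (ℕ.≤-trans (∣trit*∣≤ (trit-χ₄ d) (+ P * J d))
        (ℕ.≤-trans (subst (λ x → ∣ x ∣ ℕ.≤ B.C ℕ.* d) (trans (drop (+ P * B.tent (M ℕ.* n) d Y) (+ Y)) (cong (+ P *_) (sym (J-tent d))))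
                     (B.tent-bound (M ℕ.* n) d Y Y≤))
                   (ℕ.*-monoʳ-≤ B.C (ℕ.<⇒≤ d<E))))
        where
        Y = X ∸ d ℕ.* E
        Y≤ : Y ℕ.≤ d ℕ.* (M ℕ.* n ℕ.* P)
        Y≤ = ℕ.≤-trans (ℕ.∸-monoʳ-≤ X (ℕ.m≤n*m E d))
            (ℕ.≤-trans (ℕ.≤-reflexive (trans (ℕ.m+n∸m≡n E (M ℕ.* E)) (trans (cong (M ℕ.*_) E≡nP) (sym (ℕ.*-assoc M n P)))))
                       (ℕ.m≤n*m (M ℕ.* n ℕ.* P) d))

  upper-bound : ∣ + 4 * (+ P * tentSum χ₄ β X) ∣ ℕ.≤ P ℕ.* (E ℕ.* (72 ℕ.* E)) ℕ.+ 4 ℕ.* (E ℕ.* (B.C ℕ.* E))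
  upper-bound = subst (λ x → ∣ x ∣ ℕ.≤ P ℕ.* (E ℕ.* (72 ℕ.* E)) ℕ.+ 4 ℕ.* (E ℕ.* (B.C ℕ.* E)))
    (sym (trans (cong (λ x → + 4 * (+ P * x)) tentSum-split) (distrib (+ P) S₁ S₂)))
    (ℕ.≤-trans (ℤ.∣i+j∣≤∣i∣+∣j∣ (+ P * (+ 4 * S₁)) (+ 4 * (+ P * S₂)))
      (ℕ.+-mono-≤ (ℕ.≤-trans (ℕ.≤-reflexive (ℤ.abs-* (+ P) (+ 4 * S₁))) (ℕ.*-monoʳ-≤ P S₁-bound))
                  (ℕ.≤-trans (ℕ.≤-reflexive (ℤ.abs-* (+ 4) (+ P * S₂))) (ℕ.*-monoʳ-≤ 4 S₂-bound))))
    where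
    distrib : ∀ p x y → + 4 * (p * (x + y)) ≡ p * (+ 4 * x) + + 4 * (p * y)
    distrib = solve-∀

-- Inert primes and the choice of parameters

legendre≡-1 : ∀ {a q} .{{_ : NonZero q}} → ¬ (+ q ∣ a) → ¬ IsSquareMod a q → legendre a q ≡ -1ℤ
legendre≡-1 {a} {q} q∤a ¬square =
  trans (cong (λ b → if b then 0ℤ else if does (isSquareMod? a q) then 1ℤ else -1ℤ) (dec-false (+ q ∣? a) q∤a))
        (cong (λ b → if b then 1ℤ else -1ℤ) (dec-false (isSquareMod? a q) ¬square))

Inert : ℕ → ℕ → Set
Inert p q = Σ[ q-prime ∈ Prime q ] (q % 4 ≡ 3 × legendre (+ p) q {{prime⇒nonZero q-prime}} ≡ -1ℤ)

inert? : ∀ p q → Dec (Inert p q)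
inert? p q with prime? q
... | no ¬prime = no (¬prime ∘ proj₁)
... | yes q-prime = map′ (λ c → q-prime , c) proj₂
  ((q % 4 ℕ.≟ 3) ×-dec (legendre (+ p) q {{prime⇒nonZero q-prime}} ℤ.≟ -1ℤ))

prime-∤ : ∀ {p q} → Prime p → Prime q → p ≢ q → ¬ (p ℕ.∣ q)
prime-∤ p-prime q-prime p≢q p∣q with prime⇒irreducible q-prime p∣q
... | inj₁ p≡1 = ¬prime[1] (subst Prime p≡1 p-prime)
... | inj₂ p≡q = p≢q p≡q

even⇒2∣ : ∀ n → 2 ℕ.∣ n % 4 → 2 ℕ.∣ n
even⇒2∣ n 2∣r = subst (2 ℕ.∣_) (sym (ℕ.m≡m%n+[m/n]*n n 4))
  (ℕ.∣m∣n⇒∣m+n 2∣r (ℕ.∣n⇒∣m*n (n / 4) (ℕ.divides 2 refl)))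

2∤suc-double : ∀ i → ¬ (2 ℕ.∣ suc (i ℕ.+ i))
2∤suc-double i d = contradiction (ℕ.∣1⇒≡1 (ℕ.∣m+n∣m⇒∣n
  (subst (2 ℕ.∣_) (ℕ.+-comm 1 (i ℕ.+ i)) d) (ℕ.divides i (double i)))) λ ()
  where
  double : ∀ i → i ℕ.+ i ≡ i ℕ.* 2
  double = ℕ-solve-∀

-- E = suc M is a multiple of the period so that sums of `φ` below `E` vanish, and X = E² is a
-- multiple of the period of `χ₄`. With E = 4 K the `K` odd squares below (2K)² = X / 4 each have
-- weight at least 12 K². The condition `large` is the comparison of both bounds with common factors
-- removed.
record Parameters (P : ℕ) : Set where
  field
    K M n N : ℕ
    E≡4K : suc M ≡ 4 ℕ.* K
    E≡nP : suc M ≡ n ℕ.* P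
    X≡4N : suc M ℕ.* suc M ≡ N ℕ.* 4
    large : 72 ℕ.+ 4 ℕ.* (P ℕ.* P) ℕ.< 3 ℕ.* K

  X≡16K² : suc M ℕ.* suc M ≡ 12 ℕ.* (K ℕ.* K) ℕ.+ (K ℕ.+ K) ℕ.* (K ℕ.+ K)
  X≡16K² = trans (cong₂ ℕ._*_ E≡4K E≡4K) (eq K)
    where
    eq : ∀ k → 4 ℕ.* k ℕ.* (4 ℕ.* k) ≡ 12 ℕ.* (k ℕ.* k) ℕ.+ (k ℕ.+ k) ℕ.* (k ℕ.+ k)
    eq = ℕ-solve-∀

parameters : ∀ P .{{_ : NonZero P}} → Parameters P
parameters P = record
  { K = K
  ; M = ℕ.pred (4 ℕ.* K)
  ; n = 4 ℕ.* D
  ; N = 4 ℕ.* (K ℕ.* K)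
  ; E≡4K = E≡4K
  ; E≡nP = trans E≡4K (eq₁ P D)
  ; X≡4N = trans (cong₂ ℕ._*_ E≡4K E≡4K) (eq₂ K)
  ; large = ℕ.≤-trans (ℕ.m≤n*m D P) (ℕ.m≤n*m K 3)
  }
  where
  D K : ℕ
  D = suc (72 ℕ.+ 4 ℕ.* (P ℕ.* P))
  K = P ℕ.* D
  instance
    K≢0 : NonZero K
    K≢0 = ℕ.m*n≢0 P D
  E≡4K : suc (ℕ.pred (4 ℕ.* K)) ≡ 4 ℕ.* K
  E≡4K = ℕ.suc-pred (4 ℕ.* K) {{ℕ.m*n≢0 4 K}}
  eq₁ : ∀ x d → 4 ℕ.* (x ℕ.* d) ≡ 4 ℕ.* d ℕ.* x
  eq₁ = ℕ-solve-∀
  eq₂ : ∀ k → 4 ℕ.* k ℕ.* (4 ℕ.* k) ≡ 4 ℕ.* (k ℕ.* k) ℕ.* 4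
  eq₂ = ℕ-solve-∀

-- Both sides carry the factor `u` = 16 P K²: the lower bound becomes 48 P K³ = u · 3K, the upper
-- one u (72 + 4 P²).
bounds-incompatible : ∀ {P E K} .{{_ : NonZero P}} → E ≡ 4 ℕ.* K → 72 ℕ.+ 4 ℕ.* (P ℕ.* P) ℕ.< 3 ℕ.* K →
  ∀ T → + (K ℕ.* (12 ℕ.* (K ℕ.* K))) ℤ.≤ T →
  ¬ (∣ + 4 * (+ P * T) ∣ ℕ.≤ P ℕ.* (E ℕ.* (72 ℕ.* E)) ℕ.+ 4 ℕ.* (E ℕ.* ((P ℕ.* (P ℕ.* P) ℕ.+ 0 ℕ.* P) ℕ.* E)))
bounds-incompatible {P} {E} {K@(suc _)} E≡4K large (+ t) (ℤ.+≤+ K≤t) T≤ = contradiction 3K≤ (ℕ.<⇒≱ large)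
  where
  c u : ℕ
  c = 72
  u = P ℕ.* (16 ℕ.* (K ℕ.* K))
  instance
    K²≢0 : NonZero (K ℕ.* K)
    K²≢0 = ℕ.m*n≢0 K K
    16K²≢0 : NonZero (16 ℕ.* (K ℕ.* K))
    16K²≢0 = ℕ.m*n≢0 16 (K ℕ.* K)
    u≢0 : NonZero u
    u≢0 = ℕ.m*n≢0 P (16 ℕ.* (K ℕ.* K))
  eq₁ : ∀ p k → 4 ℕ.* (p ℕ.* (k ℕ.* (12 ℕ.* (k ℕ.* k)))) ≡ p ℕ.* (16 ℕ.* (k ℕ.* k)) ℕ.* (3 ℕ.* k)
  eq₁ = ℕ-solve-∀
  eq₂ : ∀ p e c → p ℕ.* (e ℕ.* (c ℕ.* e)) ℕ.+ 4 ℕ.* (e ℕ.* ((p ℕ.* (p ℕ.* p) ℕ.+ 0 ℕ.* p) ℕ.* e)) ≡ p ℕ.* (e ℕ.* e) ℕ.* (c ℕ.+ 4 ℕ.* (p ℕ.* p))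
  eq₂ = ℕ-solve-∀
  eq₃ : ∀ k → 4 ℕ.* k ℕ.* (4 ℕ.* k) ≡ 16 ℕ.* (k ℕ.* k)
  eq₃ = ℕ-solve-∀
  scaled : u ℕ.* (3 ℕ.* K) ℕ.≤ u ℕ.* (c ℕ.+ 4 ℕ.* (P ℕ.* P))
  scaled = begin
    u ℕ.* (3 ℕ.* K)                                           ≡⟨ eq₁ P K ⟨
    4 ℕ.* (P ℕ.* (K ℕ.* (12 ℕ.* (K ℕ.* K))))                  ≤⟨ ℕ.*-monoʳ-≤ 4 (ℕ.*-monoʳ-≤ P K≤t) ⟩
    4 ℕ.* (P ℕ.* t)                                           ≡⟨ cong (4 ℕ.*_) (ℤ.abs-* (+ P) (+ t)) ⟨
    4 ℕ.* ∣ + P * + t ∣                                       ≡⟨ ℤ.abs-* (+ 4) (+ P * + t) ⟨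
    ∣ + 4 * (+ P * + t) ∣                                     ≤⟨ T≤ ⟩
    P ℕ.* (E ℕ.* (c ℕ.* E)) ℕ.+ 4 ℕ.* (E ℕ.* ((P ℕ.* (P ℕ.* P) ℕ.+ 0 ℕ.* P) ℕ.* E))
                                                              ≡⟨ eq₂ P E c ⟩
    P ℕ.* (E ℕ.* E) ℕ.* (c ℕ.+ 4 ℕ.* (P ℕ.* P))
      ≡⟨ cong (λ x → P ℕ.* x ℕ.* (c ℕ.+ 4 ℕ.* (P ℕ.* P))) (trans (cong₂ ℕ._*_ E≡4K E≡4K) (eq₃ K)) ⟩
    u ℕ.* (c ℕ.+ 4 ℕ.* (P ℕ.* P)) ∎
    where open ℕ.≤-Reasoning
  3K≤ : 3 ℕ.* K ℕ.≤ c ℕ.+ 4 ℕ.* (P ℕ.* P)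
  3K≤ = ℕ.*-cancelˡ-≤ u scaled

-- The lower bound and the conclusion

module Main (m : ℕ) (p-prime : Prime (suc ((m ℕ.+ m) ℕ.+ (m ℕ.+ m)))) where
  open QuadraticCharacter (m ℕ.+ m) p-prime using (p; χ; χ-square; ∤-small; 2<p)
  open OddCharacter (m ℕ.+ m) p-prime {m} refl

  p%4≡1 : p % 4 ≡ 1
  p%4≡1 = trans (cong (_% 4) (eq m)) (ℕ.[m+kn]%n≡m%n 1 m 4)
    where
    eq : ∀ m → suc ((m ℕ.+ m) ℕ.+ (m ℕ.+ m)) ≡ 1 ℕ.+ m ℕ.* 4
    eq = ℕ-solve-∀

  χ≡1 : ∀ k → Prime (suc (k ℕ.+ k)) → suc (k ℕ.+ k) % 4 ≡ 3 → ¬ Inert p (suc (k ℕ.+ k)) → χ (suc (k ℕ.+ k)) ≡ 1ℤ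
  χ≡1 k q-prime q%4≡3 ¬inert =
    trans (Reciprocity.reciprocity {m ℕ.+ m} {k} {m} p-prime q-prime refl
            (prime-∤ p-prime q-prime p≢q ∘ ∣⇒∣ᵤ) q∤p)
          (GaussCharacter.χ-isSquareMod k q-prime q∤p square)
    where
    q : ℕ
    q = suc (k ℕ.+ k)
    p≢q : p ≢ q
    p≢q p≡q = contradiction (trans (sym p%4≡1) (trans (cong (_% 4) p≡q) q%4≡3)) λ ()
    q∤p : ¬ (+ q ∣ + p)
    q∤p = prime-∤ q-prime p-prime (p≢q ∘ sym) ∘ ∣⇒∣ᵤ
    square : IsSquareMod (+ p) q
    square = decidable-stable (isSquareMod? (+ p) q) λ ¬square →
      ¬inert (q-prime , q%4≡3 , legendre≡-1 {+ p} {q} q∤p ¬square)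

  favourable : ∀ q → Prime q → q ≢ 2 → ¬ Inert p q → Favourable (χ₄ q) (φ q)
  favourable q q-prime q≢2 ¬inert = cases (q % 4) refl (ℕ.m%n<n q 4)
    where
    odd-q : ¬ (2 ℕ.∣ q)
    odd-q = prime-∤ prime[2] q-prime (q≢2 ∘ sym)
    cases : ∀ r → q % 4 ≡ r → r ℕ.< 4 → Favourable (χ₄ q) (φ q)
    cases 0 q%4≡r _ = contradiction (even⇒2∣ q (subst (2 ℕ.∣_) (sym q%4≡r) (ℕ.divides 0 refl))) odd-q
    -- This includes q = p, where `φ q` is 0.
    cases 1 q%4≡r _ = first (trans (χ₄-% q) (cong χ₄ q%4≡r)) (trit-φ q)
    cases 2 q%4≡r _ = contradiction (even⇒2∣ q (subst (2 ℕ.∣_) (sym q%4≡r) (ℕ.divides 1 refl))) odd-q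
    cases 3 q%4≡3 _ = second χ₄q≡-1 (cong₂ (λ x y → x * (y * y)) χq≡1 χ₄q≡-1)
      where
      χ₄q≡-1 : χ₄ q ≡ -1ℤ
      χ₄q≡-1 = trans (χ₄-% q) (cong χ₄ q%4≡3)
      k : ℕ
      -- From q = 4 t + 3 = 2 (2 t + 1) + 1.
      k = suc (q / 4 ℕ.+ q / 4)
      eq : ∀ x → 3 ℕ.+ x ℕ.* 4 ≡ suc (suc (x ℕ.+ x) ℕ.+ suc (x ℕ.+ x))
      eq = ℕ-solve-∀
      q≡ : q ≡ suc (k ℕ.+ k)
      q≡ = trans (ℕ.m≡m%n+[m/n]*n q 4) (trans (cong (ℕ._+ q / 4 ℕ.* 4) q%4≡3) (eq (q / 4)))
      χq≡1 : χ q ≡ 1ℤ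
      χq≡1 = trans (cong χ q≡) (χ≡1 k (subst Prime q≡ q-prime) (trans (cong (_% 4) (sym q≡)) q%4≡3)
        (¬inert ∘ subst (Inert p) (sym q≡)))
    cases (suc (suc (suc (suc _)))) _ (s≤s (s≤s (s≤s (s≤s ()))))

  module LowerBound (K X : ℕ) (X≡ : X ≡ 12 ℕ.* (K ℕ.* K) ℕ.+ (K ℕ.+ K) ℕ.* (K ℕ.+ K))
                    (none : ∀ q → q ℕ.< X → ¬ Inert p q) where
    open Convolution X
    open Positivity X χ₄ φ χ₄-* φ-* refl
      (cong (_* 1ℤ) (χ-square {1} (∤-small (ℕ.<-trans (s<s z<s) 2<p)))) refl (ℤ.*-zeroʳ (χ 2))
      (λ q q-prime q<X q≢2 → favourable q q-prime q≢2 (none q q<X))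

    s : ℕ → ℕ
    s i = suc (i ℕ.+ i) ℕ.* suc (i ℕ.+ i)

    s-mono : ∀ {i j} → i ℕ.< j → s i ℕ.< s j
    s-mono i<j = ℕ.*-mono-< (s<s (ℕ.+-mono-< i<j i<j)) (s<s (ℕ.+-mono-< i<j i<j))

    s<4K² : ∀ i → i ℕ.< K → s i ℕ.< (K ℕ.+ K) ℕ.* (K ℕ.+ K)
    s<4K² i i<K = ℕ.*-mono-< small small
      where
      small : suc (i ℕ.+ i) ℕ.< K ℕ.+ K
      small = ℕ.≤-trans (ℕ.≤-reflexive (cong suc (sym (ℕ.+-suc i i)))) (ℕ.+-mono-≤ i<K i<K)

    s<X : ∀ i → i ℕ.< K → s i ℕ.< X
    s<X i i<K = ℕ.<-≤-trans (s<4K² i i<K) (ℕ.≤-trans (ℕ.m≤n+m _ (12 ℕ.* (K ℕ.* K))) (ℕ.≤-reflexive (sym X≡)))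

    summand : ℕ → ℤ
    summand n = + (X ∸ n) * conv χ₄ φ n

    summand-nonneg : ∀ n → n ℕ.< X → 0ℤ ℤ.≤ summand n
    -- `conv` at 0 is not a divisor sum, but d e = 0 makes one of the character values 0.
    summand-nonneg zero    _   = ℤ.≤-reflexive (sym (trans (cong (+ X *_) (conv-null {χ₄} {φ} 0 vanish)) (ℤ.*-zeroʳ (+ X))))
      where
      vanish : ∀ d e → d ℕ.* e ≡ 0 → χ₄ d * φ e ≡ 0ℤ
      vanish d e de≡0 with ℕ.m*n≡0⇒m≡0∨n≡0 d de≡0
      ... | inj₁ refl = ℤ.*-zeroˡ (φ e)
      ... | inj₂ refl = trans (cong (χ₄ d *_) φ-0) (ℤ.*-zeroʳ (χ₄ d))
    summand-nonneg (suc n) n<X = *-nonneg {+ (X ∸ suc n)} {conv χ₄ φ (suc n)} (ℤ.+≤+ z≤n) (conv-nonneg (suc n) z<s n<X)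

    summand-square : ∀ i → i ℕ.< K → + (12 ℕ.* (K ℕ.* K)) ℤ.≤ summand (s i)
    summand-square i i<K = ℤ.≤-trans (ℤ.+≤+ (ℕ.m+n≤o⇒m≤o∸n (12 ℕ.* (K ℕ.* K))
        (ℕ.≤-trans (ℕ.+-monoʳ-≤ (12 ℕ.* (K ℕ.* K)) (ℕ.<⇒≤ (s<4K² i i<K))) (ℕ.≤-reflexive (sym X≡)))))
      (ℤ.≤-trans (ℤ.≤-reflexive (sym (ℤ.*-identityʳ (+ (X ∸ s i)))))
        (ℤ.*-monoˡ-≤-nonNeg (+ (X ∸ s i)) (conv-square (suc (i ℕ.+ i)) z<s (2∤suc-double i) (s<X i i<K))))

    lower-bound : + (K ℕ.* (12 ℕ.* (K ℕ.* K))) ℤ.≤ tentSum χ₄ φ X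
    lower-bound = ℤ.≤-trans (ℤ.≤-reflexive (sym (∑-const K (12 ℕ.* (K ℕ.* K)))))
      (ℤ.≤-trans (∑-≤ K summand-square)
      (ℤ.≤-trans (∑-sparse K X summand s s-mono s<X summand-nonneg)
                 (ℤ.≤-reflexive (sym (tentSum-conv χ₄ φ X)))))


  -- Being inert is decidable, so refuting that no `q` below `X` is inert suffices to produce one.
  search : ∀ X → ¬ (∀ q → q ℕ.< X → ¬ Inert p q) → Σ[ q ∈ ℕ ] Inert p q
  search X ¬none with ℕ.anyUpTo? (inert? p) X
  ... | yes (q , _ , found) = q , found
  ... | no none             = contradiction (λ q q<X found → none (q , q<X , found)) ¬none

  inert : Parameters 2p → Σ[ q ∈ ℕ ] Inert p q
  inert parameters = search (suc M ℕ.* suc M) λ none →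
    bounds-incompatible {2p} {suc M} {K} E≡4K large (tentSum χ₄ φ (suc M ℕ.* suc M))
      (LowerBound.lower-bound K (suc M ℕ.* suc M) X≡16K² none)
      (UpperBound.upper-bound 2p φ trit-φ φ-periodic ∑φ≡0 ∑tφ≡0 φ-0 M n N E≡nP X≡4N)
    where open Parameters parameters

lemma1p3 : ∀ (p : ℕ) → Prime p → p % 4 ≡ 1 →
    Σ[ q ∈ ℕ ] Σ[ q-prime ∈ Prime q ]
    (q % 4 ≡ 3 × legendre (+ p) q {{prime⇒nonZero q-prime}} ≡ -1ℤ)
lemma1p3 p p-prime p%4≡1 = subst (λ p → Σ[ q ∈ ℕ ] Inert p q) (sym p≡) (Main.inert (p / 4) (subst Prime p≡ p-prime) (parameters _))
  where
  eq : ∀ x → 1 ℕ.+ x ℕ.* 4 ≡ suc ((x ℕ.+ x) ℕ.+ (x ℕ.+ x))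
  eq = ℕ-solve-∀
  p≡ : p ≡ suc ((p / 4 ℕ.+ p / 4) ℕ.+ (p / 4 ℕ.+ p / 4))
  p≡ = trans (ℕ.m≡m%n+[m/n]*n p 4) (trans (cong (ℕ._+ p / 4 ℕ.* 4) p%4≡1) (eq (p / 4)))
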